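{- Let $t\ge 0$ be an integer. In the exponential-edge chip-firing process beginning with $2^{t+2}$ chips with distinct labels at site $0$, the final configuration (when no firing move is possible) has all chips in weakly sorted order: for any chips $a<b$, the final position of $a$ is at most the final position of $b$, regardless of the choices of firing moves made.
   Context: Exponential-edge graph with parameter $t$: the vertex set is $\mathbb{Z}$; for each $0\le k\le t$ there are $2^{t-k}$ parallel edges between $k$ and $k+1$ and $2^{t-k}$ parallel edges between $-k$ and $-k-1$; all other pairs of adjacent integers are joined by a single edge. If a site has $a$ edges to its left neighbor and $b$ edges to its right neighbor, a firing move at that site chooses $a+b$ chips present there and sends the $a$ smallest of them to the left neighbor and the $b$ largest to the right neighbor. -}

module Defs where

open import Data.Nat using (ℕ; _∸_; _^_; _<_)
open import Data.Integer using (ℤ; +_; -[1+_]; 0ℤ) renaming (suc to sucℤ; pred to predℤ)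
open import Data.Fin using (Fin)
open import Data.Fin.Subset using (Subset; _∈_; _∉_; ∣_∣)
open import Relation.Binary.Construct.Closure.ReflexiveTransitive using (Star)
open import Relation.Binary.PropositionalEquality using (_≡_)
open import Relation.Nullary using (¬_)

Site : Set
Site = ℤ

-- The number of parallel edges between i and i + 1 in the exponential-edge
-- graph with parameter t; there are no edges between non-adjacent integers.
-- The edge bundle between -k-1 and -k starts at -k-1 = -[1+ k ].  For k > t,
-- truncated subtraction gives 2 ^ 0 = 1, the single edge required there.
rightEdges : ℕ → Site → ℕ
rightEdges t (+ k)    = 2 ^ (t ∸ k)
rightEdges t -[1+ k ] = 2 ^ (t ∸ k)

leftEdges : ℕ → Site → ℕ
leftEdges t s = rightEdges t (predℤ s)

Configuration : ℕ → Set
Configuration n = Fin n → Site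

-- Chips are compared by their labels.  The chips chosen by the move are
-- lefts ∪ rights.  These two sets are disjoint by lefts<rights, and the same
-- condition with the two cardinalities says that lefts consists of the
-- smallest chosen chips and rights of the largest.
record Fires {n : ℕ} (t : ℕ) (label : Fin n → ℕ) (c c′ : Configuration n) : Set where
  field
    site           : Site
    lefts rights   : Subset n
    ∣lefts∣        : ∣ lefts ∣ ≡ leftEdges t site
    ∣rights∣       : ∣ rights ∣ ≡ rightEdges t site
    lefts-present  : ∀ x → x ∈ lefts → c x ≡ site
    rights-present : ∀ x → x ∈ rights → c x ≡ site
    lefts<rights   : ∀ x y → x ∈ lefts → y ∈ rights → label x < label y
    lefts-move     : ∀ x → x ∈ lefts → c′ x ≡ predℤ site
    rights-move    : ∀ x → x ∈ rights → c′ x ≡ sucℤ site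
    others-stay    : ∀ x → x ∉ lefts → x ∉ rights → c′ x ≡ c x

Reachable : {n : ℕ} (t : ℕ) (label : Fin n → ℕ) → Configuration n → Configuration n → Set
Reachable t label = Star (Fires t label)

Final : {n : ℕ} (t : ℕ) (label : Fin n → ℕ) → Configuration n → Set
Final t label c = ∀ c′ → ¬ Fires t label c c′

allAtOrigin : {n : ℕ} → Configuration n
allAtOrigin _ = 0ℤ

{-# OPTIONS --safe #-}
module Submission where

-- Let F j be the number of chips beyond j, and measure it in units of the 2 ^ (t ∸ j) edges between
-- j and j + 1: F j = d j * 2 ^ (t ∸ j).  Along any run d j ≤ 2, and site k + 1 can fire only when
-- d k = 2.  Firing moves one unit of d from k to k + 1, or adds one unit on both sides when 0 fires,
-- so the two sides always have equal totals; hence in a final configuration every d j is maximal.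
--
-- For the labels, fix K ≥ 1 and a set o of at most 2 ^ (t + 1 - K) chips that contains every chip
-- larger than one of its members.  For j ≤ K, at most 2 ^ (t + 1 - j) - |o| chips outside o are ever
-- beyond j: when j fires, either all chips sent right belong to o, or no chip sent left does, and in
-- the second case every chip of o that took part has gone right.  At j = K with F K maximal this
-- forces all of o beyond K.  If b is the largest chip not beyond K and some smaller a is beyond K,
-- then the chips from b upwards form such a set, which is absurd.  The left side is the mirror image
-- with reversed labels, and chips ending at -1 and 1 are separated by the last firing of site 0.

open import Defs
open import Data.Bool using (Bool; true; false; _∧_; not; if_then_else_; T)
import Data.Bool.Properties as Bool
open import Data.Fin using (Fin; toℕ; zero; suc; fromℕ<)
open import Data.Fin.Properties using (toℕ<n; toℕ-fromℕ<; toℕ-injective; any?)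
import Data.Fin.Properties as Fin
open import Data.Fin.Subset using (Subset; ∣_∣; _∈_; _∉_)
open import Data.Integer using (+_; -[1+_]; +≤+; -≤+; -≤-)
  renaming (suc to sucℤ; pred to predℤ; -_ to negℤ; _≤_ to _≤ℤ_)
import Data.Integer.Properties as ℤ
open import Data.Nat
open import Data.Nat.Properties
open import Data.Nat.Tactic.RingSolver using (solve-∀)
open import Data.Product as Product using (_×_; _,_; ∃; proj₁; proj₂)
open import Data.Sum as Sum using (_⊎_; inj₁; inj₂)
open import Data.Vec using (lookup; tabulate; []; _∷_)
open import Data.Vec.Properties using ([]=⇒lookup; lookup⇒[]=; lookup∘tabulate)
open import Function using (_∘_; id)
open import Function.Definitions using (Injective)
open import Relation.Binary.Construct.Closure.ReflexiveTransitive using (Star; ε; _◅_; gmap)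
open import Relation.Binary.PropositionalEquality
open import Relation.Nullary using (¬_; contradiction; Dec; yes; no; does; ¬?; _×-dec_; _⊎-dec_)
open import Relation.Nullary.Decidable using (dec-true; dec-false)
open import Algebra.Properties.CommutativeMonoid.Sum +-0-commutativeMonoid using (sum; sum-cong-≗; ∑-distrib-+)
open import Algebra.Properties.Semiring.Sum +-*-semiring using (*-distribˡ-sum)

-- Counting

-- Turns a ring identity into an inequality without truncated subtraction: the slack between `a` and
-- `b` passes to `x` and `y`.
≤-transfer : ∀ {a b x y} → a ≤ b → x + b ≡ y + a → x ≤ y
≤-transfer {a} {b} {x} {y} a≤b eq =
  +-cancelʳ-≤ a x y (≤-trans (+-monoʳ-≤ x a≤b) (≤-reflexive eq))

𝟙 : Bool → ℕ
𝟙 true  = 1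
𝟙 false = 0

𝟙≤1 : ∀ b → 𝟙 b ≤ 1
𝟙≤1 true  = ≤-refl
𝟙≤1 false = z≤n

δ : ℕ → ℕ → ℕ
δ i j = 𝟙 (i ≡ᵇ j)

δ-refl : ∀ k → δ k k ≡ 1
δ-refl zero    = refl
δ-refl (suc k) = δ-refl k

δ-≢ : ∀ {j k} → j ≢ k → δ j k ≡ 0
δ-≢ {zero}  {zero}  j≢k = contradiction refl j≢k
δ-≢ {zero}  {suc k} j≢k = refl
δ-≢ {suc j} {zero}  j≢k = refl
δ-≢ {suc j} {suc k} j≢k = δ-≢ (j≢k ∘ cong suc)

<ᵇ-suc : ∀ j k → 𝟙 (j <ᵇ suc k) ≡ 𝟙 (j <ᵇ k) + δ j k
<ᵇ-suc zero    zero    = refl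
<ᵇ-suc zero    (suc k) = refl
<ᵇ-suc (suc j) zero    = refl
<ᵇ-suc (suc j) (suc k) = <ᵇ-suc j k

<ᵇ-irrefl : ∀ k → 𝟙 (k <ᵇ k) ≡ 0
<ᵇ-irrefl zero    = refl
<ᵇ-irrefl (suc k) = <ᵇ-irrefl k

<⇒𝟙<ᵇ : ∀ {j k} → j < k → 𝟙 (j <ᵇ k) ≡ 1
<⇒𝟙<ᵇ {zero}  {suc k} _         = refl
<⇒𝟙<ᵇ {suc j} {suc k} (s≤s j<k) = <⇒𝟙<ᵇ j<k

≮⇒𝟙<ᵇ : ∀ {j k} → ¬ j < k → 𝟙 (j <ᵇ k) ≡ 0
≮⇒𝟙<ᵇ {j}     {zero}  _   = refl
≮⇒𝟙<ᵇ {zero}  {suc k} j≮k = contradiction z<s j≮k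
≮⇒𝟙<ᵇ {suc j} {suc k} j≮k = ≮⇒𝟙<ᵇ (j≮k ∘ s≤s)

sum-mono-≤ : ∀ {n} {f g : Fin n → ℕ} → (∀ i → f i ≤ g i) → sum f ≤ sum g
sum-mono-≤ {zero}  f≤g = z≤n
sum-mono-≤ {suc n} f≤g = +-mono-≤ (f≤g zero) (sum-mono-≤ (f≤g ∘ suc))

sum-mono-< : ∀ {n} {f g : Fin n → ℕ} → (∀ i → f i ≤ g i) → ∀ i → f i < g i → sum f < sum g
sum-mono-< f≤g zero    fi<gi = +-mono-<-≤ fi<gi (sum-mono-≤ (f≤g ∘ suc))
sum-mono-< f≤g (suc i) fi<gi = +-mono-≤-< (f≤g zero) (sum-mono-< (f≤g ∘ suc) i fi<gi)

sum-≤-≡ : ∀ {n} {f g : Fin n → ℕ} → (∀ i → f i ≤ g i) → sum g ≤ sum f → ∀ i → f i ≡ g i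
sum-≤-≡ f≤g g≤f i with m≤n⇒m<n∨m≡n (f≤g i)
... | inj₁ fi<gi = contradiction (sum-mono-< f≤g i fi<gi) (≤⇒≯ g≤f)
... | inj₂ fi≡gi = fi≡gi

sum-0 : ∀ n → sum {n} (λ _ → 0) ≡ 0
sum-0 zero    = refl
sum-0 (suc n) = sum-0 n

sum-1 : ∀ n → sum {n} (λ _ → 1) ≡ n
sum-1 zero    = refl
sum-1 (suc n) = cong suc (sum-1 n)

sum-δ : ∀ {n k} → k < n → sum {n} (λ i → δ (toℕ i) k) ≡ 1
sum-δ {suc n} {zero}  _         = cong suc (sum-0 n)
sum-δ {suc n} {suc k} (s≤s k<n) = sum-δ k<n

∣p∣≡sum : ∀ {n} (p : Subset n) → ∣ p ∣ ≡ sum (λ x → 𝟙 (lookup p x))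
∣p∣≡sum []          = refl
∣p∣≡sum (true  ∷ p) = cong suc (∣p∣≡sum p)
∣p∣≡sum (false ∷ p) = ∣p∣≡sum p

sum-linear : ∀ {n} (f g h k : Fin n → ℕ) p q → (∀ i → f i + p * g i ≡ h i + q * k i) →
  sum f + p * sum g ≡ sum h + q * sum k
sum-linear f g h k p q eq = begin
  sum f + p * sum g              ≡⟨ cong₂ _+_ {x = sum f} refl (*-distribˡ-sum p g) ⟩
  sum f + sum (λ i → p * g i)    ≡⟨ ∑-distrib-+ f _ ⟨
  sum (λ i → f i + p * g i)      ≡⟨ sum-cong-≗ eq ⟩
  sum (λ i → h i + q * k i)      ≡⟨ ∑-distrib-+ h _ ⟩
  sum h + sum (λ i → q * k i)    ≡⟨ cong₂ _+_ {x = sum h} refl (*-distribˡ-sum q k) ⟨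
  sum h + q * sum k              ∎
  where open ≡-Reasoning

-- Positions and their change in one firing

depth : Site → ℕ
depth (+ k)    = k
depth -[1+ _ ] = 0

-- All sites from 0 leftwards have depth 0, so this sees only the right half-line; the left one is
-- reached through `negℤ`.
beyond : ℕ → Site → ℕ
beyond j s = 𝟙 (j <ᵇ depth s)

-- The Boolean indices are membership among the chips sent left and sent right; then come the old
-- and the new position. The pair `true`, `true` has no constructor, because the strict label order
-- makes the two sets disjoint.
data Fate (s : Site) : Bool → Bool → Site → Site → Set where
  goes-left  : ∀ {u v} → u ≡ s → v ≡ predℤ s → Fate s true false u v
  goes-right : ∀ {u v} → u ≡ s → v ≡ sucℤ s → Fate s false true u v
  stays      : ∀ {u v} → v ≡ u → Fate s false false u v

fate-mirror : ∀ {s l r u v} → Fate s l r u v → Fate (negℤ s) r l (negℤ u) (negℤ v)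
fate-mirror {s} (goes-left refl refl)  = goes-right refl (ℤ.neg-distrib-+ (-[1+ 0 ]) s)
fate-mirror {s} (goes-right refl refl) = goes-left refl (ℤ.neg-distrib-+ (+ 1) s)
fate-mirror     (stays refl)           = stays refl

-- A chip going left from k + 1 leaves the region beyond k, and a chip going right enters the region
-- beyond k + 1. Losses are added on the left-hand side to avoid subtraction.
flow-pos : ∀ {k l r u v} → Fate (+ suc k) l r u v → ∀ j →
  beyond j v + δ j k * 𝟙 l ≡ beyond j u + δ j (suc k) * 𝟙 r
flow-pos {k} (goes-left refl refl) j
  rewrite <ᵇ-suc j k | *-identityʳ (δ j k) | *-zeroʳ (δ j (suc k)) = sym (+-identityʳ _)
flow-pos {k} (goes-right refl refl) j
  rewrite <ᵇ-suc j (suc k) | *-identityʳ (δ j (suc k)) | *-zeroʳ (δ j k) = +-identityʳ _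
flow-pos {k} (stays refl) j
  rewrite *-zeroʳ (δ j k) | *-zeroʳ (δ j (suc k)) = refl

flow-origin : ∀ {l r u v} → Fate (+ 0) l r u v → ∀ j →
  beyond j v + 0 * 𝟙 l ≡ beyond j u + δ j 0 * 𝟙 r
flow-origin (goes-left refl refl) j
  rewrite *-zeroʳ (δ j 0) = refl
flow-origin (goes-right refl refl) j
  rewrite <ᵇ-suc j 0 | *-identityʳ (δ j 0) = +-identityʳ _
flow-origin (stays refl) j rewrite *-zeroʳ (δ j 0) = refl

depth-neg : ∀ {k l r u v} → Fate -[1+ k ] l r u v → depth v ≡ depth u
depth-neg         (goes-left refl refl)  = refl
depth-neg {zero}  (goes-right refl refl) = refl
depth-neg {suc k} (goes-right refl refl) = refl
depth-neg         (stays refl)           = refl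

-- A firing at 3 + k puts chips only at 2 + k and 4 + k, so a chip found at 1 has not moved.
depth1-back : ∀ {k l r u v} → Fate (+ (3 + k)) l r u v → depth v ≡ 1 → depth u ≡ 1
depth1-back (stays refl) eq = eq
depth1-back (goes-left refl refl) ()
depth1-back (goes-right refl refl) ()

-- A fired chip sits at k + 1, hence beyond k but not beyond k + 1. Summed over all chips, this
-- expresses through outflows alone that the site held enough chips.
room-pos : ∀ {k l r u v} → Fate (+ suc k) l r u v →
  𝟙 l + 𝟙 r + beyond (suc k) u ≤ beyond k u
room-pos {k} (goes-left refl _)
  rewrite <ᵇ-irrefl k | <⇒𝟙<ᵇ (n<1+n k) = ≤-refl
room-pos {k} (goes-right refl _)
  rewrite <ᵇ-irrefl k | <⇒𝟙<ᵇ (n<1+n k) = ≤-refl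
room-pos {k} {u = u} (stays _) with suc k <? depth u
... | yes p rewrite <⇒𝟙<ᵇ p | <⇒𝟙<ᵇ (<-trans (n<1+n k) p) = ≤-refl
... | no  p rewrite ≮⇒𝟙<ᵇ p = z≤n

room-origin : ∀ {l r u v} → Fate (+ 0) l r u v →
  𝟙 l + 𝟙 r + (beyond 0 u + beyond 0 (negℤ u)) ≤ 1
room-origin (goes-left refl _)  = ≤-refl
room-origin (goes-right refl _) = ≤-refl
room-origin {u = + zero}   (stays _) = z≤n
room-origin {u = + suc k}  (stays _) = ≤-refl
room-origin {u = -[1+ k ]} (stays _) = ≤-refl

fires-fate : ∀ {n t label} {c c′ : Configuration n} (φ : Fires t label c c′) → let open Fires φ in
  ∀ x → Fate site (lookup lefts x) (lookup rights x) (c x) (c′ x)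
fires-fate φ x with lookup (Fires.lefts φ) x in eqL | lookup (Fires.rights φ) x in eqR
... | true | true = contradiction
  (Fires.lefts<rights φ x x (lookup⇒[]= x _ eqL) (lookup⇒[]= x _ eqR)) (<-irrefl refl)
... | true  | false = goes-left (Fires.lefts-present φ x x∈) (Fires.lefts-move φ x x∈)
  where x∈ = lookup⇒[]= x _ eqL
... | false | true  = goes-right (Fires.rights-present φ x x∈) (Fires.rights-move φ x x∈)
  where x∈ = lookup⇒[]= x _ eqR
... | false | false = stays (Fires.others-stay φ x (∉ eqL) (∉ eqR))
  where
  ∉ : ∀ {p : Subset _} → lookup p x ≡ false → x ∉ p
  ∉ eq x∈p with () ← trans (sym ([]=⇒lookup x∈p)) eq

-- Outflows in units of the edge bundles

-- 2 for j ≤ t, 1 for j = t + 1, and 0 beyond.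
cap : ℕ → ℕ → ℕ
cap t j = 2 ⊓ (2 + t ∸ j)

cap≤2 : ∀ t j → cap t j ≤ 2
cap≤2 t j = m⊓n≤m 2 (2 + t ∸ j)

cap-beyond : ∀ {t j} → 2 + t ≤ j → cap t j ≡ 0
cap-beyond {t} {j} le rewrite m≤n⇒m∸n≡0 le = refl

cap-fill : ∀ t j → j ≤ suc t → cap t j * 2 ^ (t ∸ j) ≡ 2 ^ (suc t ∸ j)
cap-fill t       zero          _         = refl
cap-fill zero    (suc zero)    _         = refl
cap-fill zero    (suc (suc j)) (s≤s ())
cap-fill (suc t) (suc j)       (s≤s j≤t) = cap-fill t j j≤t

-- For k < t, division by 2 ^ (t ∸ suc k) turns the hypothesis into 3 + b ≤ 2 * a, which a ≤ 2
-- allows only for a = 2 and b ≤ 1. At k = t both bundles are single edges, and 2 + b ≤ a leaves a =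
-- 2 and b = 0. For k > t the cap on `a` is too small.
fire-room : ∀ t k a b → a ≤ cap t k →
  2 ^ (t ∸ k) + 2 ^ (t ∸ suc k) + b * 2 ^ (t ∸ suc k) ≤ a * 2 ^ (t ∸ k) →
  a ≡ 2 × b < cap t (suc k)
fire-room zero zero a b a≤ le
  rewrite *-identityʳ a | *-identityʳ b with ≤-antisym a≤ (≤-trans (m≤m+n 2 b) le)
... | refl = refl , s≤s (+-cancelˡ-≤ 2 b 0 le)
fire-room zero (suc k) a b a≤ le rewrite 0∸n≡0 k | *-identityʳ a | *-identityʳ b =
  contradiction (≤-trans (≤-trans (m≤m+n 2 b) le) (≤-trans a≤ (≤-trans (m⊓n≤n 2 (1 ∸ k)) (m∸n≤m 1 k)))) λ { (s≤s ()) }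
fire-room (suc t) zero a b a≤ le with *-cancelʳ-≤ (3 + b) (a * 2) (2 ^ t) (subst₂ _≤_ (lhs (2 ^ t) b) (sym (*-assoc a 2 (2 ^ t))) le)
  where
  instance _ = m^n≢0 2 t
  lhs : ∀ p b → 2 * p + p + b * p ≡ (3 + b) * p
  lhs = solve-∀
fire-room (suc t) zero 0 b a≤ le | ()
fire-room (suc t) zero 1 b a≤ le | s≤s (s≤s ())
fire-room (suc t) zero 2 b a≤ le | s≤s (s≤s (s≤s b≤1)) = refl , s≤s b≤1
fire-room (suc t) zero (suc (suc (suc a))) b (s≤s (s≤s ())) le | _
fire-room (suc t) (suc k) a b a≤ le = fire-room t k a b a≤ le

-- If `b` were below its cap, the same arithmetic would leave enough chips at k + 1 for a firing.
saturated : ∀ t k b → b ≤ cap t (suc k) →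
  ¬ (2 ^ (t ∸ k) + 2 ^ (t ∸ suc k) + b * 2 ^ (t ∸ suc k) ≤ cap t k * 2 ^ (t ∸ k)) →
  b ≡ cap t (suc k)
saturated zero zero zero          b≤ stuck = contradiction ≤-refl stuck
saturated zero zero (suc zero)    b≤ stuck = refl
saturated zero zero (suc (suc b)) (s≤s ()) stuck
saturated zero (suc k) b b≤ stuck rewrite 0∸n≡0 k = n≤0⇒n≡0 b≤
saturated (suc t) zero b b≤ stuck with m≤n⇒m<n∨m≡n b≤
... | inj₂ eq = eq
... | inj₁ (s≤s b≤1) = contradiction (≤-transfer (*-monoˡ-≤ (2 ^ t) b≤1) (eq (2 ^ t) b)) stuck
  where
  eq : ∀ p b → 2 * p + p + b * p + 1 * p ≡ 2 * (2 * p) + b * p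
  eq = solve-∀
saturated (suc t) (suc k) b b≤ stuck = saturated t k b b≤ stuck

-- Under `Side`, this adds up, over the chips on that side, the resistance of the path from 0 to the
-- chip. The window of length t + 2 contains every index with a nonzero cap.
total : ℕ → (ℕ → ℕ) → ℕ
total t d = sum {2 + t} (λ i → d (toℕ i))

record Side (t : ℕ) (f d : ℕ → ℕ) : Set where
  field
    value   : ∀ j → f j ≡ d j * 2 ^ (t ∸ j)
    bounded : ∀ j → d j ≤ cap t j

side-cong : ∀ {t f f′ d} → (∀ j → f′ j ≡ f j) → Side t f d → Side t f′ d
side-cong eq σ = record { value = λ j → trans (eq j) (Side.value σ j) ; bounded = Side.bounded σ }

record Outward (t k : ℕ) (f′ d d′ : ℕ → ℕ) : Set where
  field
    side  : Side t f′ d′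
    shift : ∀ j → d′ j + δ j k ≡ d j + δ j (suc k)
    from  : d k ≡ 2
    to    : d (suc k) < cap t (suc k)

outward : ∀ {t k f f′ d} → Side t f d →
  (∀ j → f′ j + δ j k * 2 ^ (t ∸ k) ≡ f j + δ j (suc k) * 2 ^ (t ∸ suc k)) →
  2 ^ (t ∸ k) + 2 ^ (t ∸ suc k) + f (suc k) ≤ f k →
  ∃ λ d′ → Outward t k f′ d d′
outward {t} {k} {f} {f′} {d} σ flow room = d′ , record
  { side = record { value = value′ ; bounded = bounded′ } ; shift = shift ; from = dk≡2 ; to = dk+1< }
  where
  open Side σ
  bounds : d k ≡ 2 × d (suc k) < cap t (suc k)
  bounds = fire-room t k (d k) (d (suc k)) (bounded k)
    (subst₂ _≤_ (cong₂ _+_ {x = 2 ^ (t ∸ k) + 2 ^ (t ∸ suc k)} refl (value (suc k))) (value k) room)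
  dk≡2 = proj₁ bounds
  dk+1< = proj₂ bounds
  d′ : ℕ → ℕ
  -- The truncated subtraction never cuts anything off, since `d` is 2 at k.
  d′ j = d j + δ j (suc k) ∸ δ j k
  δ≤ : ∀ j → δ j k ≤ d j + δ j (suc k)
  δ≤ j with j ≟ k
  ... | yes refl rewrite dk≡2 = ≤-trans (𝟙≤1 (k ≡ᵇ k)) (s≤s z≤n)
  ... | no j≢k rewrite δ-≢ j≢k = z≤n
  shift : ∀ j → d′ j + δ j k ≡ d j + δ j (suc k)
  shift j = m∸n+n≡m (δ≤ j)
  scale : ∀ i j → δ j i * 2 ^ (t ∸ i) ≡ δ j i * 2 ^ (t ∸ j)
  scale i j with j ≟ i
  ... | yes refl = refl
  ... | no j≢i rewrite δ-≢ j≢i = refl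
  value′ : ∀ j → f′ j ≡ d′ j * 2 ^ (t ∸ j)
  value′ j = +-cancelʳ-≡ (δ j k * 2 ^ (t ∸ k)) _ _ (begin
    f′ j + δ j k * 2 ^ (t ∸ k)                  ≡⟨ flow j ⟩
    f j + δ j (suc k) * 2 ^ (t ∸ suc k)         ≡⟨ cong₂ _+_ (value j) (scale (suc k) j) ⟩
    d j * p + δ j (suc k) * p                   ≡⟨ *-distribʳ-+ p (d j) _ ⟨
    (d j + δ j (suc k)) * p                     ≡⟨ cong (_* p) (shift j) ⟨
    (d′ j + δ j k) * p                          ≡⟨ *-distribʳ-+ p (d′ j) _ ⟩
    d′ j * p + δ j k * p                        ≡⟨ cong₂ _+_ {x = d′ j * p} refl (scale k j) ⟨
    d′ j * p + δ j k * 2 ^ (t ∸ k)              ∎)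
    where
    open ≡-Reasoning
    p = 2 ^ (t ∸ j)
  -- Only the entry at k + 1 can grow, and it was strictly below its cap.
  bounded′ : ∀ j → d′ j ≤ cap t j
  bounded′ j with j ≟ suc k
  ... | yes refl rewrite δ-refl k | +-comm (d (suc k)) 1 = ≤-trans (m∸n≤m _ (δ (suc k) k)) dk+1<
  ... | no j≢ rewrite δ-≢ j≢ | +-identityʳ (d j) = ≤-trans (m∸n≤m _ (δ j k)) (bounded j)

module _ {t k f′ d d′} (ω : Outward t k f′ d d′) where
  open Outward ω

  outward-at : suc (d′ k) ≡ 2
  outward-at with shift k
  ... | eq rewrite δ-refl k | δ-≢ {k} {suc k} (<⇒≢ (n<1+n k)) | from | +-comm (d′ k) 1 = eq

  outward-away : ∀ {j} → j ≢ k → j ≢ suc k → d′ j ≡ d j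
  outward-away {j} j≢k j≢k+1 with shift j
  ... | eq rewrite δ-≢ j≢k | δ-≢ j≢k+1 = trans (sym (+-identityʳ _)) (trans eq (+-identityʳ _))

  outward-total : total t d′ ≡ total t d
  outward-total = +-cancelʳ-≡ 1 _ _ (begin
    total t d′ + 1                                          ≡⟨ cong₂ _+_ {x = total t d′} refl (sum-δ k<) ⟨
    total t d′ + sum {2 + t} (λ i → δ (toℕ i) k)            ≡⟨ ∑-distrib-+ (d′ ∘ toℕ {2 + t}) (λ i → δ (toℕ i) k) ⟨
    sum {2 + t} (λ i → d′ (toℕ i) + δ (toℕ i) k)            ≡⟨ sum-cong-≗ {2 + t} (shift ∘ toℕ) ⟩
    sum {2 + t} (λ i → d (toℕ i) + δ (toℕ i) (suc k))       ≡⟨ ∑-distrib-+ (d ∘ toℕ {2 + t}) (λ i → δ (toℕ i) (suc k)) ⟩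
    total t d + sum {2 + t} (λ i → δ (toℕ i) (suc k))       ≡⟨ cong₂ _+_ {x = total t d} refl (sum-δ k+1<) ⟩
    total t d + 1                                           ∎)
    where
    open ≡-Reasoning
    -- The cap at k + 1 is positive, so both changed entries lie in the window of `total`.
    k+1< : suc k < 2 + t
    k+1< = ≰⇒> λ le → contradiction (subst (d (suc k) <_) (cap-beyond {t} le) to) n≮0
    k< : k < 2 + t
    k< = <-trans (n<1+n k) k+1<

  outward-positive : 1 ≤ d 0 → 1 ≤ d′ 0
  outward-positive 1≤d0 with 0 ≟ k
  ... | yes refl = ≤-reflexive (sym (suc-injective outward-at))
  ... | no 0≢k rewrite outward-away 0≢k (λ ()) = 1≤d0

  outward-zero : d 0 ≡ 0 → d′ 0 ≡ 0
  outward-zero d0≡0 with 0 ≟ k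
  ... | yes refl with () ← trans (sym from) d0≡0
  ... | no 0≢k rewrite outward-away 0≢k (λ ()) = d0≡0

-- Firing site 1 leaves d 0 = 1, and firing site 2 leaves d 1 = 1 although its cap is then 2. So a
-- firing that ends with both entries at their caps happens at site 3 or further out, and found them
-- there.
outward-stale : ∀ {t k f f′ d d′} → Side t f d → Outward t k f′ d d′ → d′ 0 ≡ 2 → d′ 1 ≡ cap t 1 →
  ∃ (λ i → k ≡ 2 + i) × d 0 ≡ 2 × d 1 ≡ cap t 1
outward-stale {k = 0} σ ω d′0 d′1 with () ← trans (sym (outward-at ω)) (cong suc d′0)
outward-stale {t} {k = 1} {d = d} σ ω d′0 d′1 = contradiction (≤-trans (≤-reflexive (sym d1≡2)) (Side.bounded σ 1))
  (<⇒≱ (≤-reflexive (trans (cong suc (sym d′1)) (outward-at ω))))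
  where d1≡2 = Outward.from ω
outward-stale {k = suc (suc i)} σ ω d′0 d′1 = (i , refl) ,
  trans (sym (outward-away ω (λ ()) (λ ()))) d′0 , trans (sym (outward-away ω (λ ()) (λ ()))) d′1

side-grow : ∀ {t f f′ d} → Side t f d → d 0 < 2 → (∀ j → f′ j ≡ f j + δ j 0 * 2 ^ t) →
  Side t f′ (λ j → d j + δ j 0)
side-grow {t} {f} {f′} {d} σ d0<2 flow = record { value = value′ ; bounded = bounded′ }
  where
  open Side σ
  value′ : ∀ j → f′ j ≡ (d j + δ j 0) * 2 ^ (t ∸ j)
  value′ zero    = trans (flow 0) (trans (cong₂ _+_ (value 0) refl) (sym (*-distribʳ-+ (2 ^ t) (d 0) 1)))
  value′ (suc j) rewrite +-identityʳ (d (suc j)) = trans (flow (suc j)) (trans (+-identityʳ _) (value (suc j)))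
  bounded′ : ∀ j → d j + δ j 0 ≤ cap t j
  bounded′ zero    rewrite +-comm (d 0) 1 = d0<2
  bounded′ (suc j) rewrite +-identityʳ (d (suc j)) = bounded (suc j)

total-grow : ∀ t d → total t (λ j → d j + δ j 0) ≡ total t d + 1
total-grow t d = trans (∑-distrib-+ (d ∘ toℕ {2 + t}) (λ i → δ (toℕ i) 0)) (cong₂ _+_ {x = total t d} refl (sum-δ {2 + t} {0} z<s))

-- Both sides of the origin

record Shape (t : ℕ) (f g d e : ℕ → ℕ) : Set where
  field
    right    : Side t f d
    left     : Side t g e
    -- Conservation of the sum, over all chips, of a function of position that is harmonic on the graph.
    balanced : total t d ≡ total t e
    -- When 0 fires, d 0 + e 0 is at most 2; this field then excludes the values 2 and 0, for which
    -- one side would exceed its cap.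
    together : (d 0 ≡ 0 × e 0 ≡ 0) ⊎ (1 ≤ d 0 × 1 ≤ e 0)

shape-swap : ∀ {t f g d e} → Shape t f g d e → Shape t g f e d
shape-swap σ = record
  { right = left ; left = right ; balanced = sym balanced
  ; together = Sum.map Product.swap Product.swap together }
  where open Shape σ

shape-outward : ∀ {t k f f′ g g′ d d′ e} → Shape t f g d e → Outward t k f′ d d′ → (∀ j → g′ j ≡ g j) →
  Shape t f′ g′ d′ e
shape-outward σ ω g≡ = record
  { right = Outward.side ω ; left = side-cong g≡ left
  ; balanced = trans (outward-total ω) balanced
  ; together = Sum.map (Product.map₁ (outward-zero ω)) (Product.map₁ (outward-positive ω)) together }
  where open Shape σ

-- Of the 4 * 2 ^ t chips the firing uses 2 * 2 ^ t, so at most two units lie off the origin;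
-- `together` leaves only the symmetric cases.
origin-room : ∀ {t f g d e} → Shape t f g d e → 2 ^ t + 2 ^ t + (f 0 + g 0) ≤ 4 * 2 ^ t →
  (d 0 ≡ 0 × e 0 ≡ 0) ⊎ (d 0 ≡ 1 × e 0 ≡ 1)
origin-room {t} {f} {g} {d} {e} σ room = cases together
  where
  open Shape σ
  lhs : ∀ p a b → p + p + (a * p + b * p) ≡ (2 + (a + b)) * p
  lhs = solve-∀
  sum≤2 : d 0 + e 0 ≤ 2
  sum≤2 = +-cancelˡ-≤ 2 _ 2 (*-cancelʳ-≤ (2 + (d 0 + e 0)) 4 (2 ^ t) (subst (_≤ 4 * 2 ^ t)
    (trans (cong₂ _+_ {x = 2 ^ t + 2 ^ t} refl (cong₂ _+_ (Side.value right 0) (Side.value left 0))) (lhs (2 ^ t) (d 0) (e 0))) room))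
    where instance _ = m^n≢0 2 t
  cases : (d 0 ≡ 0 × e 0 ≡ 0) ⊎ (1 ≤ d 0 × 1 ≤ e 0) → (d 0 ≡ 0 × e 0 ≡ 0) ⊎ (d 0 ≡ 1 × e 0 ≡ 1)
  cases (inj₁ zeros) = inj₁ zeros
  cases (inj₂ (1≤d , 1≤e)) = inj₂
    ( ≤-antisym (+-cancelʳ-≤ 1 _ 1 (≤-trans (+-monoʳ-≤ (d 0) 1≤e) sum≤2)) 1≤d
    , ≤-antisym (+-cancelˡ-≤ 1 _ 1 (≤-trans (+-monoˡ-≤ (e 0) 1≤d) sum≤2)) 1≤e )

shape-origin : ∀ {t f f′ g g′ d e} → Shape t f g d e → 2 ^ t + 2 ^ t + (f 0 + g 0) ≤ 4 * 2 ^ t →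
  (∀ j → f′ j ≡ f j + δ j 0 * 2 ^ t) → (∀ j → g′ j ≡ g j + δ j 0 * 2 ^ t) →
  Shape t f′ g′ (λ j → d j + δ j 0) (λ j → e j + δ j 0)
shape-origin {t} {d = d} {e} σ room f-flow g-flow = record
  { right = side-grow right (proj₁ <2) f-flow ; left = side-grow left (proj₂ <2) g-flow
  ; balanced = trans (total-grow t d) (trans (cong (λ z → z + 1) balanced) (sym (total-grow t e)))
  ; together = inj₂ (m≤n+m 1 (d 0) , m≤n+m 1 (e 0)) }
  where
  open Shape σ
  <2 : d 0 < 2 × e 0 < 2
  <2 with origin-room σ room
  ... | inj₁ (d0 , e0) rewrite d0 | e0 = z<s , z<s
  ... | inj₂ (d0 , e0) rewrite d0 | e0 = ≤-refl , ≤-refl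

-- The outflows of the final profile: 2 ^ (t ∸ j) chips at j + 1 for each j ≤ t, and a single chip
-- at t + 2.
Full : ℕ → (ℕ → ℕ) → Set
Full t f = (∀ {j} → j ≤ suc t → f j ≡ 2 ^ (suc t ∸ j)) × (∀ {j} → 2 + t ≤ j → f j ≡ 0)

-- For an outflow `f`, the difference of `f k` and `f (suc k)` counts the chips at k + 1, so no site
-- to the right of 0 can fire.
Stuck : ℕ → (ℕ → ℕ) → Set
Stuck t f = ∀ k → ¬ (2 ^ (t ∸ k) + 2 ^ (t ∸ suc k) + f (suc k) ≤ f k)

full : ∀ {t f d} → Side t f d → (∀ j → j < 2 + t → d j ≡ cap t j) → Full t f
full {t} {f} {d} σ d≡ =
  (λ {j} j≤ → trans (value j) (trans (cong (_* 2 ^ (t ∸ j)) (d≡ j (s≤s j≤))) (cap-fill t j j≤))) ,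
  (λ {j} j≥ → trans (value j) (cong (_* 2 ^ (t ∸ j)) (n≤0⇒n≡0 (≤-trans (bounded j) (≤-reflexive (cap-beyond {t} j≥))))))
  where open Side σ

stuck-cap : ∀ {t f d} → Side t f d → Stuck t f → d 0 ≡ 2 → ∀ j → d j ≡ cap t j
stuck-cap σ stuck d0 zero = d0
stuck-cap {t} {f} {d} σ stuck d0 (suc j) = saturated t j (d (suc j)) (bounded (suc j)) λ le →
  stuck j (subst₂ _≤_ (cong₂ _+_ {x = 2 ^ (t ∸ j) + 2 ^ (t ∸ suc j)} refl (sym (value (suc j))))
    (trans (cong (_* 2 ^ (t ∸ j)) (sym (stuck-cap σ stuck d0 j))) (sym (value j))) le)
  where open Side σ

total-cap : ∀ {t f d} → Side t f d → total t d ≡ total t (cap t) → ∀ j → j < 2 + t → d j ≡ cap t j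
total-cap {t} {f} {d} σ eq j j< = subst (λ i → d i ≡ cap t i) (toℕ-fromℕ< j<)
  (sum-≤-≡ {2 + t} (Side.bounded σ ∘ toℕ) (≤-reflexive (sym eq)) (fromℕ< j<))

-- A saturated side has the largest total that the caps allow. The other side has the same total and
-- is bounded entry by entry, so each of its entries is at its cap.
one-full⇒both : ∀ {t f g d e} → Shape t f g d e → Stuck t f → d 0 ≡ 2 →
  (∀ j → j < 2 + t → d j ≡ cap t j) × (∀ j → j < 2 + t → e j ≡ cap t j)
one-full⇒both {t} σ stuck d0 =
  (λ j _ → d≡ j) , total-cap left (trans (sym balanced) (sum-cong-≗ {2 + t} (d≡ ∘ toℕ)))
  where
  open Shape σ
  d≡ = stuck-cap right stuck d0

-- If neither d 0 nor e 0 were 2, at most two units would lie off the origin and 0 could fire. So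
-- one side starts with 2, and saturation spreads outwards from there.
stuck⇒cap : ∀ {t f g d e} → Shape t f g d e → Stuck t f → Stuck t g →
  ¬ (2 ^ t + 2 ^ t + (f 0 + g 0) ≤ 4 * 2 ^ t) →
  (∀ j → j < 2 + t → d j ≡ cap t j) × (∀ j → j < 2 + t → e j ≡ cap t j)
stuck⇒cap {t} {f} {g} {d} {e} σ f-stuck g-stuck origin-stuck with d 0 ≟ 2 | e 0 ≟ 2
... | yes d0 | _ = one-full⇒both σ f-stuck d0
... | no _ | yes e0 = Product.swap (one-full⇒both (shape-swap σ) g-stuck e0)
... | no d0≢2 | no e0≢2 = contradiction
  (≤-transfer (+-mono-≤ (*-monoˡ-≤ (2 ^ t) d0≤1) (*-monoˡ-≤ (2 ^ t) e0≤1))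
    (trans (cong (λ z → 2 ^ t + 2 ^ t + z + (1 * 2 ^ t + 1 * 2 ^ t)) (cong₂ _+_ (Side.value right 0) (Side.value left 0)))
      (eq (2 ^ t) (d 0) (e 0)))) origin-stuck
  where
  open Shape σ
  d0≤1 : d 0 ≤ 1
  d0≤1 = ≤-pred (≤∧≢⇒< (Side.bounded right 0) d0≢2)
  e0≤1 : e 0 ≤ 1
  e0≤1 = ≤-pred (≤∧≢⇒< (Side.bounded left 0) e0≢2)
  eq : ∀ p a b → p + p + (a * p + b * p) + (1 * p + 1 * p) ≡ 4 * p + (a * p + b * p)
  eq = solve-∀

-- Firings

≤-sum : ∀ {n} (f : Fin n → ℕ) x → f x ≤ sum f
≤-sum f zero    = m≤m+n _ _
≤-sum f (suc x) = m≤n⇒m≤o+n (f zero) (≤-sum (f ∘ suc) x)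

mirror : ∀ {n} → Configuration n → Configuration n
mirror c x = negℤ (c x)

crowd : ∀ {n} → (Fin n → Bool) → Configuration n → ℕ → ℕ
crowd o c j = sum (λ x → 𝟙 (o x) * beyond j (c x))

everyone : ∀ {n} → Fin n → Bool
everyone _ = true

outflow : ∀ {n} → Configuration n → ℕ → ℕ
outflow = crowd everyone

_#_ : ∀ {n} → (Fin n → Bool) → (Fin n → Bool) → ℕ
o # p = sum (λ x → 𝟙 (o x) * 𝟙 (p x))

everyone-# : ∀ {n} (p : Fin n → Bool) → everyone # p ≡ sum (𝟙 ∘ p)
everyone-# {n} p = sum-cong-≗ {n} λ x → +-identityʳ (𝟙 (p x))

#-≤ : ∀ {n} (o p : Fin n → Bool) → o # p ≤ sum (𝟙 ∘ p)
#-≤ o p = sum-mono-≤ λ x → ≤-trans (*-monoˡ-≤ (𝟙 (p x)) (𝟙≤1 (o x))) (≤-reflexive (+-identityʳ _))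

outflow≡sum : ∀ {n} (c : Configuration n) j → outflow c j ≡ sum (λ x → beyond j (c x))
outflow≡sum {n} c j = sum-cong-≗ {n} λ x → +-identityʳ (beyond j (c x))

-- The site is an index so that proofs can split on its sign; the chip sets are Boolean functions so
-- that they can be summed.
record Firing {n : ℕ} (t : ℕ) (label : Fin n → ℕ) (s : Site) (c c′ : Configuration n) : Set where
  field
    lefts rights : Fin n → Bool
    #lefts       : sum (𝟙 ∘ lefts) ≡ leftEdges t s
    #rights      : sum (𝟙 ∘ rights) ≡ rightEdges t s
    ordered      : ∀ {x y} → lefts x ≡ true → rights y ≡ true → label x < label y
    fate         : ∀ x → Fate s (lefts x) (rights x) (c x) (c′ x)

firing : ∀ {n t label} {c c′ : Configuration n} (φ : Fires t label c c′) → Firing t label (Fires.site φ) c c′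
firing φ = record
  { lefts = lookup lefts ; rights = lookup rights
  ; #lefts = trans (sym (∣p∣≡sum lefts)) ∣lefts∣ ; #rights = trans (sym (∣p∣≡sum rights)) ∣rights∣
  ; ordered = λ {x} {y} x∈ y∈ → lefts<rights x y (lookup⇒[]= x _ x∈) (lookup⇒[]= y _ y∈)
  ; fate = fires-fate φ }
  where open Fires φ

leftEdges-neg : ∀ t s → leftEdges t (negℤ s) ≡ rightEdges t s
leftEdges-neg t (+ zero)     = refl
leftEdges-neg t (+ (suc k))  = refl
leftEdges-neg t -[1+ k ]     = refl

rightEdges-neg : ∀ t s → rightEdges t (negℤ s) ≡ leftEdges t s
rightEdges-neg t (+ zero)    = refl
rightEdges-neg t (+ (suc k)) = refl
rightEdges-neg t -[1+ k ]    = refl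

-- Reflection swaps the two chip sets, so the labels are reversed; the bound `b` keeps the truncated
-- difference strictly decreasing.
firing-mirror : ∀ {n t label s b} {c c′ : Configuration n} → (∀ x → label x ≤ b) → Firing t label s c c′ →
  Firing t (λ x → b ∸ label x) (negℤ s) (mirror c) (mirror c′)
firing-mirror {t = t} {s = s} label≤b φ = record
  { lefts = rights ; rights = lefts
  ; #lefts = trans #rights (sym (leftEdges-neg t s)) ; #rights = trans #lefts (sym (rightEdges-neg t s))
  ; ordered = λ {x} x∈ y∈ → ∸-monoʳ-< (ordered y∈ x∈) (label≤b x)
  ; fate = fate-mirror ∘ fate }
  where open Firing φ

Step : ∀ {n} → ℕ → (Fin n → ℕ) → Configuration n → Configuration n → Set
Step t label c c′ = ∃ λ s → Firing t label s c c′

steps : ∀ {n t label} {c c′ : Configuration n} → Reachable t label c c′ → Star (Step t label) c c′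
steps = gmap id λ φ → Fires.site φ , firing φ

steps-mirror : ∀ {n t label b} {c c′ : Configuration n} → (∀ x → label x ≤ b) → Star (Step t label) c c′ →
  Star (Step t (λ x → b ∸ label x)) (mirror c) (mirror c′)
steps-mirror label≤b = gmap mirror λ (s , φ) → negℤ s , firing-mirror label≤b φ

crowd-flow : ∀ {n} {c c′ : Configuration n} (o l r : Fin n → Bool) j p q →
  (∀ x → beyond j (c′ x) + p * 𝟙 (l x) ≡ beyond j (c x) + q * 𝟙 (r x)) →
  crowd o c′ j + p * (o # l) ≡ crowd o c j + q * (o # r)
crowd-flow {c = c} {c′} o l r j p q eq = sum-linear _ _ _ _ p q λ x →
  trans (factor (𝟙 (o x)) (beyond j (c′ x)) p (𝟙 (l x)))
    (trans (cong (𝟙 (o x) *_) (eq x)) (sym (factor (𝟙 (o x)) (beyond j (c x)) q (𝟙 (r x)))))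
  where
  factor : ∀ w b p z → w * b + p * (w * z) ≡ w * (b + p * z)
  factor = solve-∀

crowd-cong : ∀ {n} (c c′ : Configuration n) (o : Fin n → Bool) → (∀ x → depth (c′ x) ≡ depth (c x)) →
  ∀ j → crowd o c′ j ≡ crowd o c j
crowd-cong c c′ o eq j = sum-cong-≗ λ x → cong (λ d → 𝟙 (o x) * 𝟙 (j <ᵇ d)) (eq x)

sum-+₃ : ∀ {n} (f g h : Fin n → ℕ) → sum (λ x → f x + g x + h x) ≡ sum f + sum g + sum h
sum-+₃ f g h = trans (∑-distrib-+ (λ x → f x + g x) h) (cong₂ _+_ (∑-distrib-+ f g) refl)

module _ {n t label k} {c c′ : Configuration n} (φ : Firing t label (+ suc k) c c′) where
  open Firing φ

  pos-flow : ∀ o j → crowd o c′ j + δ j k * (o # lefts) ≡ crowd o c j + δ j (suc k) * (o # rights)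
  pos-flow o j = crowd-flow {c = c} {c′} o lefts rights j (δ j k) (δ j (suc k)) λ x → flow-pos (fate x) j

  pos-outflow : ∀ j → outflow c′ j + δ j k * 2 ^ (t ∸ k) ≡ outflow c j + δ j (suc k) * 2 ^ (t ∸ suc k)
  pos-outflow j = subst₂ (λ l r → outflow c′ j + δ j k * l ≡ outflow c j + δ j (suc k) * r)
    (trans (everyone-# lefts) #lefts) (trans (everyone-# rights) #rights) (pos-flow everyone j)

  pos-room : 2 ^ (t ∸ k) + 2 ^ (t ∸ suc k) + outflow c (suc k) ≤ outflow c k
  pos-room = subst₂ _≤_
    (trans (sum-+₃ (𝟙 ∘ lefts) (𝟙 ∘ rights) _) (cong₂ _+_ (cong₂ _+_ #lefts #rights) (sym (outflow≡sum c (suc k)))))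
    (sym (outflow≡sum c k))
    (sum-mono-≤ λ x → room-pos (fate x))

  pos-mirror : ∀ x → depth (mirror c′ x) ≡ depth (mirror c x)
  pos-mirror x = depth-neg (fate-mirror (fate x))

module _ {n t label} {c c′ : Configuration n} (φ : Firing t label (+ 0) c c′) where
  open Firing φ

  origin-flow : ∀ o j → crowd o c′ j ≡ crowd o c j + δ j 0 * (o # rights)
  origin-flow o j = trans (sym (+-identityʳ _))
    (crowd-flow {c = c} {c′} o lefts rights j 0 (δ j 0) λ x → flow-origin (fate x) j)

  origin-outflow : ∀ j → outflow c′ j ≡ outflow c j + δ j 0 * 2 ^ t
  origin-outflow j = trans (origin-flow everyone j)
    (cong (λ r → outflow c j + δ j 0 * r) (trans (everyone-# rights) #rights))

  origin-enough : n ≡ 4 * 2 ^ t → 2 ^ t + 2 ^ t + (outflow c 0 + outflow (mirror c) 0) ≤ 4 * 2 ^ t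
  origin-enough n≡ = subst₂ _≤_
    (trans (sum-+₃ (𝟙 ∘ lefts) (𝟙 ∘ rights) _) (cong₂ _+_ (cong₂ _+_ #lefts #rights)
      (trans (∑-distrib-+ (beyond 0 ∘ c) (beyond 0 ∘ mirror c))
        (sym (cong₂ _+_ (outflow≡sum c 0) (outflow≡sum (mirror c) 0))))))
    (trans (sum-1 n) n≡)
    (sum-mono-≤ λ x → room-origin (fate x))

neg-depth : ∀ {n t label k} {c c′ : Configuration n} → Firing t label -[1+ k ] c c′ →
  ∀ x → depth (c′ x) ≡ depth (c x)
neg-depth φ x = depth-neg (Firing.fate φ x)

record State {n : ℕ} (t : ℕ) (label : Fin n → ℕ) (c : Configuration n) : Set where
  field
    d e    : ℕ → ℕ
    shape  : Shape t (outflow c) (outflow (mirror c)) d e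
    -- These outflows leave no chip at 0 and 2 ^ t chips at each of -1 and 1.
    sorted : d 0 ≡ 2 → e 0 ≡ 2 → d 1 ≡ cap t 1 → e 1 ≡ cap t 1 →
             ∀ a b → depth (c a) ≡ 1 → depth (mirror c b) ≡ 1 → label b < label a

outflow-origin : ∀ {n} (o : Fin n → Bool) j → crowd o allAtOrigin j ≡ 0
outflow-origin {n} o j = trans (sum-cong-≗ λ x → *-zeroʳ (𝟙 (o x))) (sum-0 n)

state-origin : ∀ {n} t label → State {n} t label allAtOrigin
state-origin {n} t label = record
  { d = λ _ → 0 ; e = λ _ → 0
  ; shape = record { right = side ; left = side ; balanced = refl ; together = inj₁ (refl , refl) }
  ; sorted = λ () }
  where
  side : Side t (outflow {n} allAtOrigin) (λ _ → 0)
  side = record { value = outflow-origin {n} everyone ; bounded = λ _ → z≤n }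

-- Since `beyond 1` is at most `beyond 0` at each chip, equal sums force equality at each chip,
-- which fails at depth 1.
depth≢1 : ∀ {n} (c : Configuration n) → outflow c 0 ≡ outflow c 1 → ∀ x → depth (c x) ≢ 1
depth≢1 c eq x d≡1 = contradiction
  (sum-≤-≡ {f = λ x → beyond 1 (c x)} {g = λ x → beyond 0 (c x)} (λ x → mono (depth (c x)))
    (≤-reflexive (trans (sym (outflow≡sum c 0)) (trans eq (outflow≡sum c 1)))) x)
  (λ p → contradiction (subst (λ d → 𝟙 (1 <ᵇ d) ≡ 𝟙 (0 <ᵇ d)) d≡1 p) λ ())
  where
  mono : ∀ d → 𝟙 (1 <ᵇ d) ≤ 𝟙 (0 <ᵇ d)
  mono zero          = z≤n
  mono (suc zero)    = z≤n
  mono (suc (suc d)) = ≤-refl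

into-depth-1 : ∀ {l r u v} → Fate (+ 0) l r u v → depth u ≢ 1 → depth v ≡ 1 → r ≡ true
into-depth-1 (goes-left refl refl) u≢1 ()
into-depth-1 (goes-right _ _) u≢1 v≡1 = refl
into-depth-1 (stays refl) u≢1 v≡1 = contradiction v≡1 u≢1

-- The order at 1 and -1 is claimed only while the first two entries on both sides are at their
-- caps. Only a firing of 0 can bring this about anew. It then finds 1 and -1 empty, so the chips
-- there afterwards all come from this one firing, which orders them.
state-step : ∀ {n t label s} {c c′ : Configuration n} → n ≡ 4 * 2 ^ t → Firing t label s c c′ →
  State t label c → State t label c′
state-step {n} {t} {label} {+ suc k} {c} {c′} n≡ φ S with outward (Shape.right (State.shape S)) (pos-outflow φ) (pos-room φ)
... | d′ , ω = record
  { d = d′ ; e = e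
  ; shape = shape-outward shape ω (crowd-cong (mirror c) (mirror c′) everyone (pos-mirror φ))
  ; sorted = sorted′ }
  where
  open State S
  sorted′ : d′ 0 ≡ 2 → e 0 ≡ 2 → d′ 1 ≡ cap t 1 → e 1 ≡ cap t 1 →
    ∀ a b → depth (c′ a) ≡ 1 → depth (mirror c′ b) ≡ 1 → label b < label a
  sorted′ d′0 e0 d′1 e1 a b da db with outward-stale (Shape.right shape) ω d′0 d′1
  ... | (i , refl) , d0 , d1 = sorted d0 e0 d1 e1 a b
    (depth1-back (Firing.fate φ a) da) (trans (sym (pos-mirror φ b)) db)
state-step {n} {t} {label} { -[1+ k ]} {c} {c′} n≡ φ S
  with outward (Shape.left (State.shape S)) (pos-outflow ψ) (pos-room ψ)
  where ψ = firing-mirror (≤-sum label) φ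
... | e′ , ω = record
  { d = d ; e = e′
  ; shape = shape-swap (shape-outward (shape-swap shape) ω (crowd-cong c c′ everyone (neg-depth φ)))
  ; sorted = sorted′ }
  where
  open State S
  sorted′ : d 0 ≡ 2 → e′ 0 ≡ 2 → d 1 ≡ cap t 1 → e′ 1 ≡ cap t 1 →
    ∀ a b → depth (c′ a) ≡ 1 → depth (mirror c′ b) ≡ 1 → label b < label a
  sorted′ d0 e′0 d1 e′1 a b da db with outward-stale (Shape.left shape) ω e′0 e′1
  ... | (i , refl) , e0 , e1 = sorted d0 e0 d1 e1 a b
    (trans (sym (neg-depth φ a)) da) (depth1-back (fate-mirror (Firing.fate φ b)) db)
state-step {n} {t} {label} {+ zero} {c} {c′} n≡ φ S = record
  { d = λ j → d j + δ j 0 ; e = λ j → e j + δ j 0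
  ; shape = shape-origin shape room (origin-outflow φ) (origin-outflow ψ)
  ; sorted = sorted′ }
  where
  open State S
  ψ = firing-mirror (≤-sum label) φ
  room = origin-enough φ n≡
  -- One unit at 0 means 2 ^ t chips, and a capped d 1 gives the same outflow at 1; hence site 1 is
  -- empty.
  flat : ∀ {f d} → Side t f d → d 0 ≡ 1 → d 1 ≡ cap t 1 → f 0 ≡ f 1
  flat σ d0 d1 = trans (trans (Side.value σ 0) (trans (cong (_* 2 ^ t) d0) (+-identityʳ _)))
    (sym (trans (Side.value σ 1) (trans (cong (_* 2 ^ (t ∸ 1)) d1) (cap-fill t 1 (s≤s z≤n)))))
  sorted′ : d 0 + 1 ≡ 2 → e 0 + 1 ≡ 2 → d 1 + 0 ≡ cap t 1 → e 1 + 0 ≡ cap t 1 →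
    ∀ a b → depth (c′ a) ≡ 1 → depth (mirror c′ b) ≡ 1 → label b < label a
  sorted′ d0 e0 d1 e1 a b da db = Firing.ordered φ
    (into-depth-1 (fate-mirror (Firing.fate φ b)) (depth≢1 (mirror c)
      (flat (Shape.left shape) (+-cancelʳ-≡ 1 _ 1 e0) (trans (sym (+-identityʳ _)) e1)) b) db)
    (into-depth-1 (Firing.fate φ a) (depth≢1 c
      (flat (Shape.right shape) (+-cancelʳ-≡ 1 _ 1 d0) (trans (sym (+-identityʳ _)) d1)) a) da)

-- Sets of large chips

Upward : ∀ {n} → (Fin n → ℕ) → (Fin n → Bool) → Set
Upward label o = ∀ {x y} → o x ≡ true → label x < label y → o y ≡ true

size : ∀ {n} → (Fin n → Bool) → ℕ
size o = sum (𝟙 ∘ o)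

record Leading {n : ℕ} (t K : ℕ) (o : Fin n → Bool) (c : Configuration n) : Set where
  field
    rightward : ∀ x → o x ≡ true → depth (mirror c x) ≡ 0
    -- Equivalently, at most 2 ^ (suc t ∸ j) ∸ size o chips outside o are beyond j.
    packed    : ∀ j → j ≤ K → size o + outflow c j ≤ 2 ^ (suc t ∸ j) + crowd o c j

leading-origin : ∀ {n t K} {o : Fin n → Bool} → size o ≤ 2 ^ (suc t ∸ K) → Leading t K o allAtOrigin
leading-origin {n} {t} {K} {o} small = record
  { rightward = λ _ _ → refl
  ; packed = λ j j≤K → subst₂ (λ a b → size o + a ≤ 2 ^ (suc t ∸ j) + b)
      (sym (outflow-origin {n} everyone j)) (sym (outflow-origin o j))
      (+-monoˡ-≤ 0 (≤-trans small (^-monoʳ-≤ 2 (∸-monoʳ-≤ (suc t) j≤K)))) }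

-- Here `z` is a common gain, `x` the loss of the whole population and `y` the loss of `o`. As y ≤
-- x, the number of outsiders beyond the threshold does not grow.
packed-step : ∀ m C {f f′ p p′ x y z} → f′ + x ≡ f + z → p′ + y ≡ p + z → y ≤ x →
  m + f ≤ C + p → m + f′ ≤ C + p′
packed-step m C {f} {f′} {p} {p′} {x} {y} {z} f-eq p-eq y≤x le = ≤-transfer (+-mono-≤ le y≤x) (begin
  m + f′ + (C + p + x)   ≡⟨ lhs m f′ C p x ⟩
  m + C + p + (f′ + x)   ≡⟨ cong (λ q → m + C + p + q) f-eq ⟩
  m + C + p + (f + z)    ≡⟨ middle m C p f z ⟩
  m + C + f + (p + z)    ≡⟨ cong (λ q → m + C + f + q) p-eq ⟨
  m + C + f + (p′ + y)   ≡⟨ rhs m C f p′ y ⟩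
  C + p′ + (m + f + y)   ∎)
  where
  open ≡-Reasoning
  lhs : ∀ m f′ C p x → m + f′ + (C + p + x) ≡ m + C + p + (f′ + x)
  lhs = solve-∀
  middle : ∀ m C p f z → m + C + p + (f + z) ≡ m + C + f + (p + z)
  middle = solve-∀
  rhs : ∀ m C f p′ y → m + C + f + (p′ + y) ≡ C + p′ + (m + f + y)
  rhs = solve-∀

-- A member of `o` sent left has a smaller label than every chip sent right, and upward closure puts
-- all of those into `o`.
rights⊆⊎lefts∩≡∅ : ∀ {n t label s} {c c′ : Configuration n} {o : Fin n → Bool} →
  Upward label o → (φ : Firing t label s c c′) → let open Firing φ in
  (∀ y → rights y ≡ true → o y ≡ true) ⊎ (∀ x → lefts x ≡ true → o x ≡ false)
rights⊆⊎lefts∩≡∅ {o = o} up φ with any? (λ x → (Firing.lefts φ x Bool.≟ true) ×-dec (o x Bool.≟ true))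
... | yes (x , x∈lefts , x∈o) = inj₁ λ y y∈ → up x∈o (Firing.ordered φ x∈lefts y∈)
... | no none = inj₂ λ x x∈lefts → Bool.¬-not λ x∈o → none (x , x∈lefts , x∈o)

⊆⇒#≡ : ∀ {n} (o p : Fin n → Bool) → (∀ y → p y ≡ true → o y ≡ true) → o # p ≡ size p
⊆⇒#≡ {n} o p p⊆o = sum-cong-≗ {n} pointwise
  where
  pointwise : ∀ x → 𝟙 (o x) * 𝟙 (p x) ≡ 𝟙 (p x)
  pointwise x with p x in eq
  ... | false = *-zeroʳ (𝟙 (o x))
  ... | true rewrite p⊆o x eq = refl

-- A member of `o` beyond k either ends beyond k + 1 or stays unfired at k + 1, where `beyond k u`
-- on the right pays for it.
pos-kept : ∀ {k l r u v} o → Fate (+ suc k) l r u v → (l ≡ true → o ≡ false) →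
  𝟙 o * beyond k u + 𝟙 l + 𝟙 r + beyond (suc k) u ≤ 𝟙 o * beyond (suc k) v + beyond k u
pos-kept {k} o (goes-left refl refl) lo rewrite lo refl | <ᵇ-irrefl k | <⇒𝟙<ᵇ (n<1+n k) = ≤-refl
pos-kept {k} o (goes-right refl refl) lo rewrite <ᵇ-irrefl k | <⇒𝟙<ᵇ (n<1+n k) =
  ≤-reflexive (trans (+-identityʳ _) (cong (_+ 1) (+-identityʳ _)))
pos-kept {k} {u = u} o (stays refl) lo with suc k <? depth u
... | yes p rewrite <⇒𝟙<ᵇ p | <⇒𝟙<ᵇ (<-trans (n<1+n k) p) =
  ≤-reflexive (cong (_+ 1) (trans (+-identityʳ _) (+-identityʳ _)))
... | no p rewrite ≮⇒𝟙<ᵇ p | *-zeroʳ (𝟙 o) | +-identityʳ (𝟙 o * beyond k u) | +-identityʳ (𝟙 o * beyond k u) | +-identityʳ (𝟙 o * beyond k u) =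
  ≤-trans (*-monoˡ-≤ (beyond k u) (𝟙≤1 o)) (≤-reflexive (+-identityʳ _))

-- A member of `o` that is not beyond 0 afterwards has stayed at 0, where the chip contributes
-- nothing else to the left-hand side.
origin-kept : ∀ {l r u v} o → Fate (+ 0) l r u v → (l ≡ true → o ≡ false) → (o ≡ true → depth (negℤ u) ≡ 0) →
  𝟙 o + 𝟙 l + 𝟙 r + (beyond 0 u + beyond 0 (negℤ u)) ≤ 𝟙 o * beyond 0 v + 1
origin-kept o (goes-left refl refl) lo ro rewrite lo refl = ≤-refl
origin-kept true  (goes-right refl refl) lo ro = ≤-refl
origin-kept false (goes-right refl refl) lo ro = ≤-refl
origin-kept {u = + zero}   true (stays refl) lo ro = ≤-refl
origin-kept {u = + suc k}  true (stays refl) lo ro = ≤-refl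
origin-kept {u = -[1+ k ]} true (stays refl) lo ro with () ← ro refl
origin-kept {u = + zero}   false (stays refl) lo ro = z≤n
origin-kept {u = + suc k}  false (stays refl) lo ro = ≤-refl
origin-kept {u = -[1+ k ]} false (stays refl) lo ro = ≤-refl

leading-step : ∀ {n t label s K} {c c′ : Configuration n} {o : Fin n → Bool} → n ≡ 4 * 2 ^ t →
  Upward label o → size o ≤ 2 ^ t → K ≤ suc t →
  Firing t label s c c′ → State t label c → Leading t K o c → Leading t K o c′
leading-step {n} {t} {label} {+ suc k} {K} {c} {c′} {o} n≡ up small K≤ φ S Λ = record
  { rightward = λ x x∈o → trans (pos-mirror φ x) (rightward x x∈o) ; packed = packed′ }
  where
  open Leading Λ
  open Firing φ
  open State S
  -- Here `o` and the whole population gain equally beyond j: either all chips sent right are in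
  -- `o`, or j differs from k + 1 and nobody enters.
  simple : ∀ j → j ≤ K → δ j (suc k) * (o # rights) ≡ δ j (suc k) * 2 ^ (t ∸ suc k) →
    size o + outflow c′ j ≤ 2 ^ (suc t ∸ j) + crowd o c′ j
  simple j j≤K eq = packed-step (size o) (2 ^ (suc t ∸ j)) (pos-outflow φ j)
    (trans (pos-flow φ o j) (cong (λ z → crowd o c j + z) eq))
    (*-monoʳ-≤ (δ j k) (≤-trans (#-≤ o lefts) (≤-reflexive #lefts))) (packed j j≤K)
  -- The outflow at k is at its maximum, so packing there puts all of `o` beyond k. None of them
  -- goes left, so those not beyond k + 1 afterwards are unfired chips at k + 1.
  hard : suc k ≤ K → (∀ x → lefts x ≡ true → o x ≡ false) →
    size o + outflow c′ (suc k) ≤ 2 ^ (t ∸ k) + crowd o c′ (suc k)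
  hard k<K none = +-cancelʳ-≤ L _ _ (begin
    size o + outflow c′ (suc k) + L                     ≡⟨ cong (λ z → size o + z + L) grown ⟩
    size o + (outflow c (suc k) + R) + L                ≤⟨ +-monoˡ-≤ L (+-monoˡ-≤ (outflow c (suc k) + R) ones≤) ⟩
    crowd o c k + (outflow c (suc k) + R) + L           ≡⟨ shuffle (crowd o c k) (outflow c (suc k)) R L ⟩
    crowd o c k + L + R + outflow c (suc k)             ≤⟨ kept ⟩
    crowd o c′ (suc k) + outflow c k                    ≡⟨ cong (λ z → crowd o c′ (suc k) + z) emptied ⟩
    crowd o c′ (suc k) + 2 * L                          ≡⟨ unfold (crowd o c′ (suc k)) L ⟩
    L + crowd o c′ (suc k) + L                          ∎)
    where
    open ≤-Reasoning
    L = 2 ^ (t ∸ k)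
    R = 2 ^ (t ∸ suc k)
    shuffle : ∀ a b c d → a + (b + c) + d ≡ a + d + c + b
    shuffle = solve-∀
    unfold : ∀ a b → a + 2 * b ≡ b + a + b
    unfold = solve-∀
    ω = proj₂ (outward (Shape.right shape) (pos-outflow φ) (pos-room φ))
    dk≡2 = Outward.from ω
    emptied : outflow c k ≡ 2 * L
    emptied = trans (Side.value (Shape.right shape) k) (cong (_* L) dk≡2)
    capacity : 2 * L ≡ 2 ^ (suc t ∸ k)
    capacity = trans (cong (_* L) (≤-antisym (≤-trans (≤-reflexive (sym dk≡2)) (Side.bounded (Shape.right shape) k)) (cap≤2 t k)))
      (cap-fill t k (≤-trans (n≤1+n k) (≤-trans k<K K≤)))
    ones≤ : size o ≤ crowd o c k
    ones≤ = +-cancelʳ-≤ (outflow c k) _ _ (≤-trans (packed k (<⇒≤ k<K))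
      (≤-reflexive (trans (cong (λ z → z + crowd o c k) (trans (sym capacity) (sym emptied))) (+-comm (outflow c k) _))))
    grown : outflow c′ (suc k) ≡ outflow c (suc k) + R
    grown with pos-outflow φ (suc k)
    ... | eq rewrite δ-refl k | δ-≢ {suc k} {k} (≢-sym (<⇒≢ (n<1+n k))) =
      trans (sym (+-identityʳ _)) (trans eq (cong (λ z → outflow c (suc k) + z) (+-identityʳ R)))
    kept : crowd o c k + L + R + outflow c (suc k) ≤ crowd o c′ (suc k) + outflow c k
    kept = subst₂ _≤_
      (trans (∑-distrib-+ (λ x → 𝟙 (o x) * beyond k (c x) + 𝟙 (lefts x) + 𝟙 (rights x)) _)
        (cong₂ _+_ (trans (sum-+₃ _ (𝟙 ∘ lefts) (𝟙 ∘ rights)) (cong₂ _+_ (cong₂ _+_ {x = crowd o c k} refl #lefts) #rights))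
          (sym (outflow≡sum c (suc k)))))
      (trans (∑-distrib-+ (λ x → 𝟙 (o x) * beyond (suc k) (c′ x)) _) (cong₂ _+_ {x = crowd o c′ (suc k)} refl (sym (outflow≡sum c k))))
      (sum-mono-≤ λ x → pos-kept (o x) (fate x) (none x))
  packed′ : ∀ j → j ≤ K → size o + outflow c′ j ≤ 2 ^ (suc t ∸ j) + crowd o c′ j
  packed′ j j≤K with rights⊆⊎lefts∩≡∅ {o = o} up φ | j ≟ suc k
  ... | inj₁ all | _ = simple j j≤K (cong (δ j (suc k) *_) (trans (⊆⇒#≡ o rights all) #rights))
  ... | inj₂ _ | no j≢ = simple j j≤K (trans (cong (_* (o # rights)) (δ-≢ j≢)) (cong (_* 2 ^ (t ∸ suc k)) (sym (δ-≢ j≢))))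
  ... | inj₂ none | yes refl = hard j≤K none
leading-step {n} {t} {label} { -[1+ k ]} {K} {c} {c′} {o} n≡ up small K≤ φ S Λ = record
  { rightward = λ x x∈o → stay x (rightward x x∈o) (fate x)
  ; packed = λ j j≤K → subst₂ (λ a b → size o + a ≤ 2 ^ (suc t ∸ j) + b)
      (sym (crowd-cong c c′ everyone (neg-depth φ) j)) (sym (crowd-cong c c′ o (neg-depth φ) j)) (packed j j≤K) }
  where
  open Leading Λ
  open Firing φ
  stay : ∀ x {l r} → depth (mirror c x) ≡ 0 → Fate -[1+ k ] l r (c x) (c′ x) → depth (mirror c′ x) ≡ 0
  stay x d≡0 (goes-left eq _) with () ← trans (sym (cong (depth ∘ negℤ) eq)) d≡0
  stay x d≡0 (goes-right eq _) with () ← trans (sym (cong (depth ∘ negℤ) eq)) d≡0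
  stay x d≡0 (stays eq) = trans (cong (depth ∘ negℤ) eq) d≡0
leading-step {n} {t} {label} {+ zero} {K} {c} {c′} {o} n≡ up small K≤ φ S Λ = record
  { rightward = λ x x∈o → rightward′ x x∈o refl refl (fate x) ; packed = packed′ }
  where
  open Leading Λ
  open Firing φ
  open State S
  rightward′ : ∀ x → o x ≡ true → ∀ {l r} → lefts x ≡ l → rights x ≡ r →
    Fate (+ 0) l r (c x) (c′ x) → depth (mirror c′ x) ≡ 0
  -- If a member of `o` went left, `o` would contain it and all 2 ^ t chips sent right, against
  -- `small`.
  rightward′ x x∈o x∈l x∉r (goes-left _ _) with rights⊆⊎lefts∩≡∅ {o = o} up φ
  ... | inj₂ none with () ← trans (sym x∈o) (none x x∈l)
  ... | inj₁ all = contradiction (≤-trans small (≤-reflexive (sym #rights)))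
    (<⇒≱ (sum-mono-< {f = 𝟙 ∘ rights} {g = 𝟙 ∘ o} rights≤o x
      (subst₂ _<_ (cong 𝟙 (sym x∉r)) (cong 𝟙 (sym x∈o)) z<s)))
    where
    rights≤o : ∀ y → 𝟙 (rights y) ≤ 𝟙 (o y)
    rights≤o y with rights y in eq
    ... | false = z≤n
    ... | true rewrite all y eq = ≤-refl
  rightward′ x x∈o _ _ (goes-right _ eq) = cong (depth ∘ negℤ) eq
  rightward′ x x∈o _ _ (stays eq) = trans (cong (depth ∘ negℤ) eq) (rightward x x∈o)
  P = 2 ^ t
  packed′ : ∀ j → j ≤ K → size o + outflow c′ j ≤ 2 ^ (suc t ∸ j) + crowd o c′ j
  packed′ (suc j) j≤K = subst₂ (λ a b → size o + a ≤ 2 ^ (t ∸ j) + b)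
    (sym (trans (origin-outflow φ (suc j)) (+-identityʳ _))) (sym (trans (origin-flow φ o (suc j)) (+-identityʳ _))) (packed (suc j) j≤K)
  packed′ zero j≤K with rights⊆⊎lefts∩≡∅ {o = o} up φ
  ... | inj₁ all = packed-step (size o) (2 ^ suc t) {x = 0} {y = 0}
    (trans (+-identityʳ _) (origin-outflow φ 0))
    (trans (+-identityʳ _) (trans (origin-flow φ o 0) (cong (λ z → crowd o c 0 + 1 * z) (trans (⊆⇒#≡ o rights all) #rights))))
    z≤n (packed 0 j≤K)
  ... | inj₂ none with origin-room shape (origin-enough φ n≡)
  -- Nothing was to the right before, so just the 2 ^ t chips sent right are beyond 0, and `o` has
  -- at most 2 ^ t members.
  ...   | inj₁ (d0 , _) = ≤-trans (≤-reflexive (cong (λ z → size o + z) grown))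
    (≤-trans (+-monoˡ-≤ (1 * P) small) (m≤m+n _ _))
    where
    grown : outflow c′ 0 ≡ 1 * P
    grown = trans (origin-outflow φ 0) (cong (λ z → z + 1 * P) (trans (Side.value (Shape.right shape) 0) (cong (_* P) d0)))
  ...   | inj₂ (d0 , e0) = ≤-trans (+-mono-≤ ones≤ (≤-reflexive grown))
      (≤-reflexive (+-comm (crowd o c′ 0) _))
    where
    filled : ∀ {f d} → Side t f d → d 0 ≡ 1 → f 0 ≡ P
    filled σ d0 = trans (Side.value σ 0) (trans (cong (_* P) d0) (+-identityʳ P))
    grown : outflow c′ 0 ≡ 2 ^ suc t
    grown = trans (origin-outflow φ 0) (cong (λ z → z + 1 * P) (filled (Shape.right shape) d0))
    quadruple : ∀ p → p + p + (p + p) ≡ 4 * p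
    quadruple = solve-∀
    assoc : ∀ m p → m + (p + p + (p + p)) ≡ m + p + p + (p + p)
    assoc = solve-∀
    -- With 2 ^ t chips already on each side, every chip at 0 takes part. No member of `o` goes left
    -- or was on the left, so all of `o` ends beyond 0.
    ones≤ : size o ≤ crowd o c′ 0
    ones≤ = +-cancelʳ-≤ (4 * P) _ _ (subst₂ _≤_
      (trans (∑-distrib-+ (λ x → 𝟙 (o x) + 𝟙 (lefts x) + 𝟙 (rights x)) (λ x → beyond 0 (c x) + beyond 0 (mirror c x)))
        (trans (cong₂ _+_ (trans (sum-+₃ (𝟙 ∘ o) (𝟙 ∘ lefts) (𝟙 ∘ rights)) (cong₂ _+_ (cong (λ z → size o + z) #lefts) #rights))
          (trans (∑-distrib-+ (beyond 0 ∘ c) (beyond 0 ∘ mirror c))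
            (cong₂ _+_ (trans (sym (outflow≡sum c 0)) (filled (Shape.right shape) d0))
                       (trans (sym (outflow≡sum (mirror c) 0)) (filled (Shape.left shape) e0)))))
          (trans (sym (assoc (size o) P)) (cong (λ z → size o + z) (quadruple P)))))
      (trans (∑-distrib-+ (λ x → 𝟙 (o x) * beyond 0 (c′ x)) (λ _ → 1)) (cong (λ z → crowd o c′ 0 + z) (trans (sum-1 n) n≡)))
      (sum-mono-≤ λ x → origin-kept (o x) (fate x) (none x) (rightward x)))

-- Final configurations

intermediate-value : (h : ℕ → ℕ) → (∀ i → h (suc i) ≤ suc (h i)) → h 0 ≡ 0 →
  ∀ {m} i → m ≤ h i → ∃ λ j → h j ≡ m
intermediate-value h slow h0 zero m≤ = 0 , trans h0 (sym (n≤0⇒n≡0 (≤-trans m≤ (≤-reflexive h0))))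
intermediate-value h slow h0 {m} (suc i) m≤ with m ≤? h i
... | yes m≤hi = intermediate-value h slow h0 i m≤hi
... | no m≰hi  = suc i , ≤-antisym (≤-trans (slow i) (≰⇒> m≰hi)) m≤

shrink : ∀ {n} (p : Fin n → Bool) m → m ≤ size p → ∃ λ q → size q ≡ m × (∀ x → q x ≡ true → p x ≡ true)
shrink {zero}  p zero m≤ = p , refl , λ ()
shrink {suc n} p zero m≤ = (λ _ → false) , sum-0 (suc n) , λ _ ()
shrink {suc n} p (suc m) m≤ with p zero in eq
... | true  = cons (shrink (p ∘ suc) m (≤-pred m≤))
  where
  cons : ∃ (λ q → size q ≡ m × (∀ x → q x ≡ true → p (suc x) ≡ true)) →
    ∃ λ q → size q ≡ suc m × (∀ x → q x ≡ true → p x ≡ true)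
  cons (q , #q , q⊆p) = (λ { zero → true ; (suc x) → q x }) , cong suc #q , λ { zero _ → eq ; (suc x) → q⊆p x }
... | false = cons (shrink (p ∘ suc) (suc m) m≤)
  where
  cons : ∃ (λ q → size q ≡ suc m × (∀ x → q x ≡ true → p (suc x) ≡ true)) →
    ∃ λ q → size q ≡ suc m × (∀ x → q x ≡ true → p x ≡ true)
  cons (q , #q , q⊆p) = (λ { zero → false ; (suc x) → q x }) , #q , λ { zero () ; (suc x) → q⊆p x }

does⇒ : ∀ {A : Set} (a? : Dec A) → does a? ≡ true → A
does⇒ (yes a) _ = a

at : Site → Site → Bool
at s u = does (u ℤ.≟ s)

size-tabulate : ∀ {n} (p : Fin n → Bool) → ∣ tabulate p ∣ ≡ size p
size-tabulate p = trans (∣p∣≡sum (tabulate p)) (sum-cong-≗ (cong 𝟙 ∘ lookup∘tabulate p))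

tabulate-∈ : ∀ {n} {p : Fin n → Bool} {x} → x ∈ tabulate p → p x ≡ true
tabulate-∈ {p = p} {x} x∈ = trans (sym (lookup∘tabulate p x)) ([]=⇒lookup x∈)

tabulate-∉ : ∀ {n} {p : Fin n → Bool} {x} → x ∉ tabulate p → p x ≡ false
tabulate-∉ {p = p} {x} x∉ = Bool.¬-not λ px → x∉ (lookup⇒[]= x _ (trans (lookup∘tabulate p x) px))

∧-true : ∀ {a b} → a ∧ b ≡ true → a ≡ true × b ≡ true
∧-true {true} {true} _ = refl , refl

size-unique : ∀ {n} (label : Fin n → ℕ) → Injective _≡_ _≡_ label → ∀ i → sum (λ x → δ (label x) i) ≤ 1
size-unique {zero}  label inj i = z≤n
size-unique {suc n} label inj i with label zero ≟ i
... | no  ≢i rewrite δ-≢ ≢i = size-unique (label ∘ suc) (Fin.suc-injective ∘ inj) i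
... | yes refl rewrite δ-refl (label zero) = s≤s (≤-reflexive (trans
  (sum-cong-≗ {n} λ x → δ-≢ (Fin.0≢1+n ∘ sym ∘ inj {suc x} {zero})) (sum-0 n)))

-- A label threshold cuts off exactly enough chips for the left: labels are distinct, so the count
-- below it grows by at most one at a time, and past the sum of all labels it covers every chip at
-- the site. Any of the remaining chips can go right.
enabled : ∀ {n} t (label : Fin n → ℕ) → Injective _≡_ _≡_ label → ∀ c s →
  leftEdges t s + rightEdges t s ≤ size (at s ∘ c) → ∃ (Fires t label c)
enabled {n} t label inj c s enough with intermediate-value below slow below-0 (suc (sum label)) L≤
  where
  L = leftEdges t s
  below : ℕ → ℕ
  below i = size (λ x → at s (c x) ∧ (label x <ᵇ i))
  slow : ∀ i → below (suc i) ≤ suc (below i)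
  slow i = ≤-trans (≤-trans (sum-mono-≤ pointwise) (≤-reflexive (∑-distrib-+ (λ x → 𝟙 (at s (c x) ∧ (label x <ᵇ i))) _)))
    (≤-trans (+-monoʳ-≤ (below i) (size-unique label inj i)) (≤-reflexive (+-comm (below i) 1)))
    where
    pointwise : ∀ x → 𝟙 (at s (c x) ∧ (label x <ᵇ suc i)) ≤ 𝟙 (at s (c x) ∧ (label x <ᵇ i)) + δ (label x) i
    pointwise x with at s (c x)
    ... | false = z≤n
    ... | true  = ≤-reflexive (<ᵇ-suc (label x) i)
  below-0 : below 0 ≡ 0
  below-0 = trans (sum-cong-≗ {n} λ x → cong 𝟙 (Bool.∧-zeroʳ (at s (c x)))) (sum-0 n)
  L≤ : L ≤ below (suc (sum label))
  L≤ = ≤-trans (m≤m+n L _) (≤-trans enough (sum-mono-≤ pointwise))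
    where
    pointwise : ∀ x → 𝟙 (at s (c x)) ≤ 𝟙 (at s (c x) ∧ (label x <ᵇ suc (sum label)))
    pointwise x with at s (c x)
    ... | false = z≤n
    ... | true  = ≤-reflexive (sym (<⇒𝟙<ᵇ (s≤s (≤-sum label x))))
... | θ , #low with shrink (λ x → at s (c x) ∧ not (label x <ᵇ θ)) (rightEdges t s) R≤
  where
  R≤ : rightEdges t s ≤ size (λ x → at s (c x) ∧ not (label x <ᵇ θ))
  R≤ = +-cancelˡ-≤ (leftEdges t s) _ _ (≤-trans enough (≤-reflexive (trans (sum-cong-≗ pointwise)
    (trans (∑-distrib-+ (λ x → 𝟙 (at s (c x) ∧ (label x <ᵇ θ))) _) (cong₂ _+_ #low refl)))))
    where
    pointwise : ∀ x → 𝟙 (at s (c x)) ≡ 𝟙 (at s (c x) ∧ (label x <ᵇ θ)) + 𝟙 (at s (c x) ∧ not (label x <ᵇ θ))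
    pointwise x with at s (c x) | label x <ᵇ θ
    ... | false | _     = refl
    ... | true  | true  = refl
    ... | true  | false = refl
... | high , #high , high⊆ = c′ , record
  { site = s ; lefts = tabulate low ; rights = tabulate high
  ; ∣lefts∣ = trans (size-tabulate low) #low ; ∣rights∣ = trans (size-tabulate high) #high
  ; lefts-present = λ x x∈ → does⇒ (c x ℤ.≟ s) (proj₁ (∧-true (tabulate-∈ x∈)))
  ; rights-present = λ x x∈ → does⇒ (c x ℤ.≟ s) (proj₁ (∧-true (high⊆ x (tabulate-∈ x∈))))
  ; lefts<rights = λ x y x∈ y∈ → <-≤-trans (low<θ (tabulate-∈ x∈)) (θ≤high (tabulate-∈ y∈))
  ; lefts-move = λ x x∈ → cong (λ b → if b then predℤ s else if high x then sucℤ s else c x) (tabulate-∈ x∈)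
  ; rights-move = λ x x∈ → moved-right x (tabulate-∈ x∈)
  ; others-stay = λ x x∉l x∉r → cong₂ (λ a b → if a then predℤ s else if b then sucℤ s else c x) (tabulate-∉ x∉l) (tabulate-∉ x∉r)
  }
  where
  low : Fin n → Bool
  low x = at s (c x) ∧ (label x <ᵇ θ)
  c′ : Configuration n
  c′ x = if low x then predℤ s else if high x then sucℤ s else c x
  low<θ : ∀ {x} → low x ≡ true → label x < θ
  low<θ {x} x∈ = <ᵇ⇒< (label x) θ (subst T (sym (proj₂ (∧-true x∈))) _)
  θ≤high : ∀ {y} → high y ≡ true → θ ≤ label y
  θ≤high {y} y∈ with label y <ᵇ θ in eq | proj₂ (∧-true {at s (c y)} (high⊆ y y∈))
  ... | false | _ = ≮⇒≥ λ y<θ → subst T eq (<⇒<ᵇ y<θ)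
  moved-right : ∀ x → high x ≡ true → c′ x ≡ sucℤ s
  moved-right x x∈ = cong₂ (λ a b → if a then predℤ s else if b then sucℤ s else c x)
    (Bool.¬-not λ x∈low → <⇒≱ (low<θ x∈low) (θ≤high x∈)) x∈

-- Occupation of sites in terms of outflows

drop-level : ∀ {u k} → depth u ≢ suc k → beyond k u ≤ beyond (suc k) u
drop-level {u} {k} ≢ with k <? depth u
... | no p rewrite ≮⇒𝟙<ᵇ p = z≤n
... | yes p rewrite <⇒𝟙<ᵇ (≤∧≢⇒< p (≢ ∘ sym)) = 𝟙≤1 (k <ᵇ depth u)

at-pos : ∀ k u → beyond k u ≤ 𝟙 (at (+ suc k) u) + beyond (suc k) u
at-pos k u with u ℤ.≟ + suc k
... | yes _ = ≤-trans (𝟙≤1 (k <ᵇ depth u)) (s≤s z≤n)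
... | no u≢ = drop-level {u} (u≢ ∘ depth≡⇒ u)
  where
  depth≡⇒ : ∀ u → depth u ≡ suc k → u ≡ + suc k
  depth≡⇒ (+ _) refl = refl

at-neg : ∀ k u → beyond k (negℤ u) ≤ 𝟙 (at -[1+ k ] u) + beyond (suc k) (negℤ u)
at-neg k u with u ℤ.≟ -[1+ k ]
... | yes _ = ≤-trans (𝟙≤1 (k <ᵇ depth (negℤ u))) (s≤s z≤n)
... | no u≢ = drop-level {negℤ u} (u≢ ∘ depth≡⇒ u)
  where
  depth≡⇒ : ∀ u → depth (negℤ u) ≡ suc k → u ≡ -[1+ k ]
  depth≡⇒ -[1+ _ ] refl = refl
  depth≡⇒ (+ zero) ()
  depth≡⇒ (+ suc _) ()

at-origin : ∀ u → 1 ≤ 𝟙 (at (+ 0) u) + (beyond 0 u + beyond 0 (negℤ u))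
at-origin (+ zero)   = ≤-refl
at-origin (+ suc k)  = ≤-refl
at-origin -[1+ k ]   = ≤-refl

module _ {n t label} (inj : Injective _≡_ _≡_ label) {c : Configuration n} (final : Final t label c) where

  crowded : ∀ s → ¬ (leftEdges t s + rightEdges t s ≤ size (at s ∘ c))
  crowded s enough with enabled t label inj c s enough
  ... | c′ , φ = final c′ φ

  final-right : Stuck t (outflow c)
  final-right k le = crowded (+ suc k) (+-cancelʳ-≤ (outflow c (suc k)) _ _ (≤-trans le
    (subst₂ _≤_ (sym (outflow≡sum c k))
      (trans (∑-distrib-+ (𝟙 ∘ at (+ suc k) ∘ c) _) (cong (λ z → size (at (+ suc k) ∘ c) + z) (sym (outflow≡sum c (suc k)))))
      (sum-mono-≤ (at-pos k ∘ c)))))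

  final-left : Stuck t (outflow (mirror c))
  final-left k le = crowded -[1+ k ] (+-cancelʳ-≤ (outflow (mirror c) (suc k)) _ _ (≤-trans
    -- At -k-1 the outward bundle is the left one, so the two powers occur in the opposite order.
    (≤-reflexive (cong (λ z → z + outflow (mirror c) (suc k)) (+-comm (2 ^ (t ∸ suc k)) _))) (≤-trans le
    (subst₂ _≤_ (sym (outflow≡sum (mirror c) k))
      (trans (∑-distrib-+ (𝟙 ∘ at -[1+ k ] ∘ c) _) (cong (λ z → size (at -[1+ k ] ∘ c) + z) (sym (outflow≡sum (mirror c) (suc k)))))
      (sum-mono-≤ (at-neg k ∘ c))))))

  final-origin : n ≡ 4 * 2 ^ t → ¬ (2 ^ t + 2 ^ t + (outflow c 0 + outflow (mirror c) 0) ≤ 4 * 2 ^ t)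
  final-origin n≡ le = crowded (+ 0) (+-cancelʳ-≤ (outflow c 0 + outflow (mirror c) 0) _ _ (≤-trans le
    (subst₂ _≤_ (trans (sum-1 n) n≡)
      (trans (∑-distrib-+ (𝟙 ∘ at (+ 0) ∘ c) _) (cong (λ z → size (at (+ 0) ∘ c) + z)
        (trans (∑-distrib-+ (beyond 0 ∘ c) _) (sym (cong₂ _+_ (outflow≡sum c 0) (outflow≡sum (mirror c) 0))))))
      (sum-mono-≤ (at-origin ∘ c)))))

-- Order of the final positions

preserved : ∀ {n t label} {P : Configuration n → Set} → (∀ {s c c′} → Firing t label s c c′ → P c → P c′) →
  ∀ {c c′} → Star (Step t label) c c′ → P c → P c′
preserved step ε pc = pc
preserved {P = P} step ((s , φ) ◅ φs) pc = preserved {P = P} step φs (step φ pc)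

reachable-state : ∀ {n t label} {c : Configuration n} → n ≡ 4 * 2 ^ t →
  Star (Step t label) allAtOrigin c → State t label c
reachable-state {t = t} {label} n≡ φs = preserved {P = State t label} (state-step n≡) φs (state-origin t label)

reachable-leading : ∀ {n t label K} {c : Configuration n} {o : Fin n → Bool} → n ≡ 4 * 2 ^ t →
  Upward label o → 1 ≤ K → K ≤ suc t → size o ≤ 2 ^ (suc t ∸ K) →
  Star (Step t label) allAtOrigin c → Leading t K o c
reachable-leading {t = t} {label} {K} {o = o} n≡ up 1≤K K≤ small φs = proj₂
  (preserved {P = λ c → State t label c × Leading t K o c}
    (λ φ (S , Λ) → state-step n≡ φ S , leading-step n≡ up (≤-trans small (^-monoʳ-≤ 2 (∸-monoʳ-≤ (suc t) 1≤K))) K≤ φ S Λ)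
    φs (state-origin t label , leading-origin {o = o} small))

-- In the full profile the outflow at K uses up the whole allowance 2 ^ (suc t ∸ K), so packing at K
-- leaves no member of `o` behind.
top-beyond : ∀ {n t label K} {c : Configuration n} {o : Fin n → Bool} → n ≡ 4 * 2 ^ t →
  Upward label o → 1 ≤ K → K ≤ suc t → size o ≤ 2 ^ (suc t ∸ K) → Star (Step t label) allAtOrigin c →
  Full t (outflow c) → ∀ x → o x ≡ true → K < depth (c x)
top-beyond {n} {t} {K = K} {c} {o} n≡ up 1≤K K≤ small φs (full , _) x x∈o with K <? depth (c x)
... | yes p = p
... | no p = contradiction (trans (sym (everything x)) (trans (cong (𝟙 (o x) *_) (≮⇒𝟙<ᵇ p)) (*-zeroʳ (𝟙 (o x)))))
  (λ eq → contradiction (trans (sym (cong 𝟙 x∈o)) eq) λ ())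
  where
  size≤ : size o ≤ crowd o c K
  size≤ = +-cancelʳ-≤ (outflow c K) _ _ (≤-trans (Leading.packed (reachable-leading {o = o} n≡ up 1≤K K≤ small φs) K ≤-refl)
    (≤-reflexive (trans (cong (λ z → z + crowd o c K) (sym (full K≤))) (+-comm (outflow c K) _))))
  everything : ∀ x → 𝟙 (o x) * beyond K (c x) ≡ 𝟙 (o x)
  everything = sum-≤-≡ (λ x → ≤-trans (*-monoʳ-≤ (𝟙 (o x)) (𝟙≤1 (K <ᵇ depth (c x)))) (≤-reflexive (*-identityʳ _))) size≤

right-sorted : ∀ {n t label} {c : Configuration n} → n ≡ 4 * 2 ^ t → Star (Step t label) allAtOrigin c →
  Full t (outflow c) → ∀ {K} → 1 ≤ K → ∀ {a b} → label a < label b → K < depth (c a) → K < depth (c b)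
right-sorted {n} {t} {label} {c} n≡ φs Φ {K} 1≤K {a} {b₀} a<b₀ K<a with K <? depth (c b₀)
... | yes p = p
... | no p = contradiction p (refute (sum label) b₀ a<b₀ (m≤m+n _ _))
  where
  K≤ : K ≤ suc t
  -- From t + 2 on the outflow is 0, whereas `a` is beyond K.
  K≤ = ≮⇒≥ λ K> → contradiction
    (sum-≤-≡ {f = λ _ → 0} {g = λ x → beyond K (c x)} (λ _ → z≤n)
      (≤-reflexive (trans (trans (sym (outflow≡sum c K)) (proj₂ Φ K>)) (sym (sum-0 n)))) a)
    λ eq → contradiction (trans eq (<⇒𝟙<ᵇ K<a)) λ ()
  -- Climbs to a chip not beyond K that has no such chip above it. Labels are bounded by their sum,
  -- so the fuel suffices.
  refute : ∀ fuel b → label a < label b → sum label ≤ fuel + label b → ¬ ¬ K < depth (c b)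
  refute fuel b a<b enough K≮b with any? (λ x → (label b <? label x) ×-dec ¬? (K <? depth (c x)))
  refute zero b a<b enough K≮b | yes (x , b<x , _) = <⇒≱ b<x (≤-trans (≤-sum label x) enough)
  refute (suc fuel) b a<b enough K≮b | yes (x , b<x , K≮x) = refute fuel x (<-trans a<b b<x)
    (≤-trans enough (≤-trans (≤-reflexive (sym (+-suc fuel _))) (+-monoʳ-≤ fuel b<x))) K≮x
  refute _ b a<b enough K≮b | no greatest = K≮b
    (top-beyond n≡ up 1≤K K≤ (≤-trans small (≤-reflexive (proj₁ Φ K≤))) φs Φ b
      (dec-true ((label b <? label b) ⊎-dec (b Fin.≟ b)) (inj₂ refl)))
    where
    o : Fin n → Bool
    o x = does ((label b <? label x) ⊎-dec (x Fin.≟ b))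
    up : Upward label o
    up {x} {y} x∈o x<y with does⇒ ((label b <? label x) ⊎-dec (x Fin.≟ b)) x∈o
    ... | inj₁ b<x  = dec-true ((label b <? label y) ⊎-dec (y Fin.≟ b)) (inj₁ (<-trans b<x x<y))
    ... | inj₂ refl = dec-true ((label b <? label y) ⊎-dec (y Fin.≟ b)) (inj₁ x<y)
    -- Every member of `o` other than `b` is beyond K, and `a`, which is beyond K but outside `o`,
    -- makes up for `b`.
    pointwise : ∀ x → 𝟙 (o x) + δ (toℕ x) (toℕ a) ≤ beyond K (c x) + δ (toℕ x) (toℕ b)
    pointwise x with x Fin.≟ a
    ... | yes refl
      rewrite dec-false ((label b <? label x) ⊎-dec (x Fin.≟ b)) (λ { (inj₁ b<x) → <-asym a<b b<x ; (inj₂ refl) → <-irrefl refl a<b })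
        | <⇒𝟙<ᵇ K<a | δ-refl (toℕ x) = s≤s z≤n
    ... | no x≢a rewrite δ-≢ (x≢a ∘ toℕ-injective) | +-identityʳ (𝟙 (o x)) with o x in x∈o
    ...   | false = z≤n
    ...   | true with does⇒ ((label b <? label x) ⊎-dec (x Fin.≟ b)) x∈o
    ...     | inj₂ refl rewrite δ-refl (toℕ x) = m≤n+m 1 _
    ...     | inj₁ b<x with K <? depth (c x)
    ...       | yes K<x rewrite <⇒𝟙<ᵇ K<x = s≤s z≤n
    ...       | no K≮x = contradiction (x , b<x , K≮x) greatest
    small : size o ≤ outflow c K
    small = +-cancelʳ-≤ 1 _ _ (subst₂ _≤_
      (trans (∑-distrib-+ (𝟙 ∘ o) (λ x → δ (toℕ x) (toℕ a))) (cong (λ z → size o + z) (sum-δ (toℕ<n a))))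
      (trans (∑-distrib-+ (beyond K ∘ c) (λ x → δ (toℕ x) (toℕ b))) (cong₂ _+_ (sym (outflow≡sum c K)) (sum-δ (toℕ<n b))))
      (sum-mono-≤ pointwise))

-- The full outflows at 0 are 2 * 2 ^ t on each side, which already accounts for all chips.
origin-empty : ∀ {n t} {c : Configuration n} → n ≡ 4 * 2 ^ t →
  Full t (outflow c) → Full t (outflow (mirror c)) → ∀ x → c x ≢ + 0
origin-empty {n} {t} {c} n≡ (Φ , _) (Ψ , _) x cx≡0 = contradiction
  (sum-≤-≡ {g = λ _ → 1} (λ x → bound (c x)) (≤-reflexive (begin
    sum {n} (λ _ → 1)                                   ≡⟨ sum-1 n ⟩
    n                                                   ≡⟨ n≡ ⟩
    4 * 2 ^ t                                           ≡⟨ double (2 ^ t) ⟩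
    2 * 2 ^ t + 2 * 2 ^ t                               ≡⟨ cong₂ _+_ (Φ z≤n) (Ψ z≤n) ⟨
    outflow c 0 + outflow (mirror c) 0                  ≡⟨ cong₂ _+_ (outflow≡sum c 0) (outflow≡sum (mirror c) 0) ⟩
    sum (beyond 0 ∘ c) + sum (beyond 0 ∘ mirror c)      ≡⟨ ∑-distrib-+ (beyond 0 ∘ c) _ ⟨
    sum (λ x → beyond 0 (c x) + beyond 0 (mirror c x))  ∎)) x)
  λ eq → contradiction (trans (sym (cong (λ u → beyond 0 u + beyond 0 (negℤ u)) cx≡0)) eq) λ ()
  where
  open ≡-Reasoning
  double : ∀ p → 4 * p ≡ 2 * p + 2 * p
  double = solve-∀
  bound : ∀ u → beyond 0 u + beyond 0 (negℤ u) ≤ 1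
  bound (+ zero)  = z≤n
  bound (+ suc _) = ≤-refl
  bound -[1+ _ ]  = ≤-refl

-- If u were to the right of v, some level k ≥ 1 on one of the sides would detect it, except for u =
-- 1 and v = -1, which the last hypothesis excludes.
≤-by-depth : ∀ u v → u ≢ + 0 → v ≢ + 0 →
  (∀ {k} → 1 ≤ k → k < depth u → k < depth v) → (∀ {k} → 1 ≤ k → k < depth (negℤ v) → k < depth (negℤ u)) →
  (depth u ≡ 1 → depth (negℤ v) ≢ 1) → u ≤ℤ v
≤-by-depth (+ zero) v u≢0 v≢0 _ _ _ = contradiction refl u≢0
≤-by-depth u (+ zero) u≢0 v≢0 _ _ _ = contradiction refl v≢0
≤-by-depth (+ suc zero) (+ suc j) _ _ _ _ _ = +≤+ (s≤s z≤n)
≤-by-depth (+ suc (suc i)) (+ suc j) _ _ r _ _ = +≤+ (r (s≤s z≤n) ≤-refl)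
≤-by-depth (+ suc (suc i)) -[1+ j ] _ _ r _ _ = contradiction (r ≤-refl (s≤s (s≤s z≤n))) λ ()
≤-by-depth (+ suc zero) -[1+ zero ] _ _ _ _ m = contradiction refl (m refl)
≤-by-depth (+ suc zero) -[1+ suc j ] _ _ _ l _ = contradiction (l ≤-refl (s≤s (s≤s z≤n))) λ ()
≤-by-depth -[1+ i ] (+ suc j) _ _ _ _ _ = -≤+
≤-by-depth -[1+ i ] -[1+ zero ] _ _ _ _ _ = -≤- z≤n
≤-by-depth -[1+ i ] -[1+ suc j ] _ _ _ l _ = -≤- (≤-pred (l (s≤s z≤n) ≤-refl))

theorem3p7 : (t : ℕ) (label : Fin (2 ^ (t + 2)) → ℕ) → Injective _≡_ _≡_ label →
    (c : Configuration (2 ^ (t + 2))) →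
    Reachable t label allAtOrigin c → Final t label c →
    ∀ a b → label a < label b → c a ≤ℤ c b
theorem3p7 t label inj c reach final a b a<b = ≤-by-depth (c a) (c b)
  (origin-empty {c = c} n≡ Φ Ψ a) (origin-empty {c = c} n≡ Φ Ψ b)
  (λ 1≤k → right-sorted n≡ (steps reach) Φ 1≤k a<b)
  -- On the left the reflected run is used; its reversed labels put `b` below `a`.
  (λ 1≤k → right-sorted n≡ (steps-mirror (≤-sum label) (steps reach)) Ψ 1≤k (∸-monoʳ-< a<b (≤-sum label b)))
  λ da db → <-asym a<b (sorted (d≡ 0 z<s) (e≡ 0 z<s) (d≡ 1 (s≤s z<s)) (e≡ 1 (s≤s z<s)) a b da db)
  where
  n≡ : 2 ^ (t + 2) ≡ 4 * 2 ^ t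
  n≡ = trans (^-distribˡ-+-* 2 t 2) (*-comm (2 ^ t) 4)
  open State (reachable-state n≡ (steps reach))
  caps = stuck⇒cap shape (final-right inj final) (final-left inj final) (final-origin inj final n≡)
  d≡ = proj₁ caps
  e≡ = proj₂ caps
  Φ : Full t (outflow c)
  Φ = full (Shape.right shape) d≡
  Ψ : Full t (outflow (mirror c))
  Ψ = full (Shape.left shape) e≡
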